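{- Let $h>1$ be an integer, $q=2^h$, and let $U$ be a subset of $\mathrm{GF}(q)^{\star}$ with $|U|<\frac{q}{4}-1$. Let $\Omega$ be a regular hyperoval of $AG(2,q^2)$. Then $\Omega^{\star}=\Omega\cap\Phi$ is a complete arc in the projective closure $\overline{\mathcal M_U(q^2)}$, i.e. no three points of $\Omega^{\star}$ lie on a common line of $\overline{\mathcal M_U(q^2)}$, and no point of $\overline{\mathcal M_U(q^2)}$ outside $\Omega^{\star}$ can be added to $\Omega^{\star}$ so that the resulting set still has no three points on a common line of $\overline{\mathcal M_U(q^2)}$.
   Context: For a prime power $q$, the norm is $\|x\|=x^{q+1}$ for $x\in\mathrm{GF}(q^2)$, so $\|x\|\in\mathrm{GF}(q)$. For a proper subset $U$ of $\mathrm{GF}(q)^{\star}=\mathrm{GF}(q)\setminus\{0\}$, define on $\mathrm{GF}(q^2)$ the product $a\odot b=ab$ if $\|b\|\notin U$ and $a\odot b=a^q b$ if $\|b\|\in U$. The affine plane $\mathcal M_U(q^2)$ (the dual of an André plane) has as points the points $P(x,y)$, $x,y\in\mathrm{GF}(q^2)$, of $AG(2,q^2)$, and as lines the sets $[c]=\{P(x,y): x=c\}$ for $c\in\mathrm{GF}(q^2)$ and $[m,n]=\{P(x,y): y=m\odot x+n\}$ for $m,n\in\mathrm{GF}(q^2)$. Its projective closure $\overline{\mathcal M_U(q^2)}$ is obtained in the usual way by adding one point at infinity for each parallel class of lines (the lines $[m,n]$ with fixed $m$ form one class; the lines $[c]$ form another) and a line at infinity consisting of these points. Set $\Phi=\{P(x,y):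 \|x\|\notin U\}$ and $\Psi=\{P(x,y):\|x\|\in U\}$. For $q$ even, a regular hyperoval of $PG(2,q^2)$ is the union of a non-degenerate conic and its nucleus; a regular hyperoval of $AG(2,q^2)$ is a regular hyperoval of $PG(2,q^2)$ all of whose $q^2+2$ points are affine points. An arc is a set of points no three of which are collinear; it is complete if it is not contained in a strictly larger arc. -}

module Defs where

open import Level using (0ℓ)
open import Algebra.Bundles using (CommutativeRing)
open import Algebra.Core using (Op₁; Op₂)
open import Algebra.Structures using (IsCommutativeRing)
import Algebra.Properties.Semiring.Exp as Exp
open import Data.Empty using (⊥)
open import Data.Fin.Base using (Fin)
open import Data.List.Base using (List; tabulate; filter; length)
open import Data.Nat.Base as ℕ using (ℕ)
open import Data.Product.Base using (Σ; ∃; ∃-syntax; _×_; _,_; proj₁)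
open import Data.Sum.Base using (_⊎_)
open import Data.Unit.Base using (⊤)
open import Function.Bundles using (_↔_; _⇔_; Inverse)
open import Relation.Binary.PropositionalEquality.Core using (_≡_; _≢_)
open import Relation.Nullary.Decidable.Core using (yes; no)
open import Relation.Nullary.Negation.Core using (¬_)
open import Relation.Unary using (Pred; Decidable; _∪_; _∩_; _∈_; _∉_; ｛_｝)

record FiniteField (n : ℕ) : Set₁ where
  infixl 7 _*_
  infixl 6 _+_ _-_
  field
    Carrier           : Set
    _+_ _*_           : Op₂ Carrier
    -_                : Op₁ Carrier
    0# 1#             : Carrier
    isCommutativeRing : IsCommutativeRing _≡_ _+_ _*_ -_ 0# 1#
    0≢1               : 0# ≢ 1#
    inverse           : ∀ x → x ≢ 0# → ∃[ y ] x * y ≡ 1#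
    enumeration       : Fin n ↔ Carrier

  commutativeRing : CommutativeRing 0ℓ 0ℓ
  commutativeRing = record { isCommutativeRing = isCommutativeRing }

  open Exp (CommutativeRing.semiring commutativeRing) public
    using (_^_)

  _-_ : Op₂ Carrier
  x - y = x + (- y)

  elements : List Carrier
  elements = tabulate (Inverse.to enumeration)

  card : {U : Pred Carrier 0ℓ} → Decidable U → ℕ
  card U? = length (filter U? elements)

-- GF(q) \ {0} inside GF(q²), where GF(q) is the fixed field of x ↦ x^q.
GF⋆ : ∀ {n} (F : FiniteField n) (q : ℕ) → Pred (FiniteField.Carrier F) 0ℓ
GF⋆ F q x = x ^ q ≡ x × x ≢ 0#
  where open FiniteField F

module ProjectivePlane {n : ℕ} (F : FiniteField n) where
  open FiniteField F

  Vec₃ : Set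
  Vec₃ = Carrier × Carrier × Carrier

  𝟎 : Vec₃
  𝟎 = 0# , 0# , 0#

  _⊕_ : Vec₃ → Vec₃ → Vec₃
  (x , y , z) ⊕ (x′ , y′ , z′) = x + x′ , y + y′ , z + z′

  _·_ : Carrier → Vec₃ → Vec₃
  t · (x , y , z) = t * x , t * y , t * z

  -- Points are homogeneous coordinate vectors, to be compared with _∼_, not _≡_;
  -- lines are given by their (dual) coordinate vectors.
  PGPoint PGLine : Set
  PGPoint = Σ Vec₃ (_≢ 𝟎)
  PGLine  = Σ Vec₃ (_≢ 𝟎)

  _∼_ : PGPoint → PGPoint → Set
  (v , _) ∼ (w , _) = ∃[ t ] t ≢ 0# × v ≡ t · w

  _on_ : PGPoint → PGLine → Set
  ((x , y , z) , _) on ((k , l , m) , _) = k * x + l * y + m * z ≡ 0#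

  record QuadraticForm : Set where
    constructor quadraticForm
    field a b c f g h : Carrier

    eval : Vec₃ → Carrier
    eval (x , y , z) =
      a * (x * x) + b * (y * y) + c * (z * z) + f * (y * z) + g * (x * z) + h * (x * y)

    polar : Vec₃ → Vec₃ → Carrier
    polar v w = eval (v ⊕ w) - eval v - eval w

  open QuadraticForm using (eval; polar)

  -- The form cannot be written in fewer variables after a linear change of
  -- coordinates.  In characteristic 2 the polar form always has a nonzero
  -- radical, so the condition eval Q v ≡ 0# cannot be dropped.
  NonDegenerate : QuadraticForm → Set
  NonDegenerate Q = ∀ v → eval Q v ≡ 0# → (∀ w → polar Q v w ≡ 0#) → v ≡ 𝟎

  Conic : QuadraticForm → Pred PGPoint 0ℓ
  Conic Q P = eval Q (proj₁ P) ≡ 0#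

  IsTangent : QuadraticForm → PGLine → Set
  IsTangent Q ℓ =
    ∃[ P ] (P ∈ Conic Q × P on ℓ × (∀ P′ → P′ ∈ Conic Q → P′ on ℓ → P′ ∼ P))

  IsNucleus : QuadraticForm → PGPoint → Set
  IsNucleus Q N = ∀ ℓ → IsTangent Q ℓ → N on ℓ

  IsRegularHyperoval : Pred PGPoint 0ℓ → Set
  IsRegularHyperoval H =
    ∃[ Q ] ∃[ N ] (NonDegenerate Q × IsNucleus Q N
                   × (∀ P → P ∈ H ⇔ (P ∈ Conic Q ⊎ P ∼ N)))

  -- The set of points of PG(2,F) with coordinates (x , y , 1), for (x , y) ∈ S.
  FromAffine : Pred (Carrier × Carrier) 0ℓ → Pred PGPoint 0ℓ
  FromAffine S (v , _) = ∃[ x ] ∃[ y ] ((x , y) ∈ S × ∃[ t ] (t ≢ 0# × v ≡ t · (x , y , 1#)))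

  -- Every point of FromAffine Ω is affine, so no point of the hyperoval lies at
  -- infinity.
  IsAffineRegularHyperoval : Pred (Carrier × Carrier) 0ℓ → Set
  IsAffineRegularHyperoval Ω = IsRegularHyperoval (FromAffine Ω)

module DualAndréPlane {n : ℕ} (F : FiniteField n) (q : ℕ)
    {U : Pred (FiniteField.Carrier F) 0ℓ} (U? : Decidable U) where
  open FiniteField F

  ∥_∥ : Carrier → Carrier
  ∥ x ∥ = x ^ (q ℕ.+ 1)

  infixl 7 _⊙_
  _⊙_ : Op₂ Carrier
  a ⊙ b with U? ∥ b ∥
  ... | yes _ = (a ^ q) * b
  ... | no  _ = a * b

  Φ : Pred (Carrier × Carrier) 0ℓ
  Φ (x , y) = ∥ x ∥ ∉ U

  -- slope m is the point at infinity of the lines [ m ∣ n ], and vertical that of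
  -- the lines [ c ].
  data Point : Set where
    P        : (x y : Carrier) → Point
    slope    : (m : Carrier) → Point
    vertical : Point

  data Line : Set where
    [_]   : (c : Carrier) → Line
    [_∣_] : (m n : Carrier) → Line
    ℓ∞    : Line

  _on_ : Point → Line → Set
  P x y    on [ c ]      = x ≡ c
  P x y    on [ m ∣ n ]  = y ≡ m ⊙ x + n
  P x y    on ℓ∞         = ⊥
  slope m  on [ c ]      = ⊥
  slope m  on [ m′ ∣ n ] = m ≡ m′
  slope m  on ℓ∞         = ⊤
  vertical on [ c ]      = ⊤
  vertical on [ m ∣ n ]  = ⊥
  vertical on ℓ∞         = ⊤

  IsArc : Pred Point 0ℓ → Set
  IsArc K = ∀ A B C → A ∈ K → B ∈ K → C ∈ K → A ≢ B → A ≢ C → B ≢ C →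
            ∀ ℓ → ¬ (A on ℓ × B on ℓ × C on ℓ)

  IsCompleteArc : Pred Point 0ℓ → Set
  IsCompleteArc K = IsArc K × (∀ A → A ∉ K → ¬ IsArc (K ∪ ｛ A ｝))

  Points : Pred (Carrier × Carrier) 0ℓ → Pred Point 0ℓ
  Points S (P x y)   = (x , y) ∈ S
  Points S (slope m) = ⊥
  Points S vertical  = ⊥

  _⋆ : Pred (Carrier × Carrier) 0ℓ → Pred Point 0ℓ
  Ω ⋆ = Points (Ω ∩ Φ)

{-# OPTIONS --safe #-}

-- In characteristic 2 a regular hyperoval of AG(2,q²) is, up to translation, the set where an
-- anisotropic binary quadratic form S takes a value in {0,1}.  So each affine line meeting it meets it
-- in exactly two points, and the conic is parametrised by τ ↦ (1/p(τ), τ²/p(τ)) with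
-- p(τ)² = S(1,τ²).  A line of the dual André plane meets Φ as an affine line does, hence Ω⋆ is an arc.
--
-- Suppose a further point A extends it.  Through each point of Ω⋆ the line joining it to A meets Ω in a
-- second point, necessarily in Ψ, and |Ω ∩ Ψ| ≤ 2(q+1)|U|.  If A is at infinity or in Φ, this
-- gives q² ≤ 4(q+1)|U|, which is false.  If A = P(x₀,y₀) lies in Ψ, the relevant lines are
-- y = mx + m^q x₀ + y₀, which belong to a dual Baer subplane.  A point (x,y) lies on one of them if
-- ‖x‖ ≠ ‖x₀‖; if ‖x‖ = ‖x₀‖ it lies on at most q, and on none unless it is fixed by the Baer involution.
-- Whether the involution maps the conic point τ to the conic is a polynomial condition of degree 4 in
-- τ^q.  Either it always holds, so that the involution fixes both points of Ω on a line as soon as it fixes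
-- one of them, which is impossible if the other is in Φ; or Ω has at most 6 fixed points and
-- q² ≤ 4(q+1)|U| + 6q, which is again false.

module Submission where

open import Defs
open import Level using (0ℓ)
open import Algebra.Bundles using (CommutativeRing; RawRing)
import Algebra.Properties.CommutativeMonoid.Sum as BigOp
import Algebra.Properties.CommutativeSemiring.Exp as CExp
import Algebra.Properties.Ring as RingProps
import Algebra.Properties.Semiring.Mult as SMult
import Algebra.Solver.Ring as RingSolver
open import Algebra.Solver.Ring.AlmostCommutativeRing using (fromCommutativeRing; _-Raw-AlmostCommutative⟶_)
open import Data.Bool.Base using (Bool; true; false; _xor_; _∧_)
import Data.Bool.Properties as Bool
open import Data.Empty using (⊥; ⊥-elim)
open import Data.Fin.Base using (Fin; zero; suc)
open import Data.Fin.Permutation using (Permutation; permutation; _⟨$⟩ʳ_)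
import Data.Fin.Properties as Fin
open import Data.List.Base using (List; []; _∷_; length; filter; map; concatMap; lookup; _++_)
open import Data.List.Membership.Propositional using (_∈_; lose)
open import Data.List.Membership.Propositional.Properties using (∈-tabulate⁺; ∈-filter⁺; ∈-filter⁻; ∈-map⁺; ∈-++⁺ˡ; ∈-++⁺ʳ; ∈-concatMap⁺)
open import Data.List.Properties using (length-++; length-map)
open import Data.List.Relation.Unary.All as All using (All; []; _∷_)
import Data.List.Relation.Unary.All.Properties as All
open import Data.List.Relation.Unary.AllPairs using ([]; _∷_)
open import Data.List.Relation.Unary.Any using (here; there; index)
open import Data.List.Relation.Unary.Any.Properties using (lookup-index)
open import Data.List.Relation.Unary.Unique.Propositional using (Unique)
import Data.List.Relation.Unary.Unique.Propositional.Properties as Unique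
open import Data.Maybe.Base using (Maybe; just; nothing)
open import Data.Nat.Base as ℕ using (ℕ; zero; suc; _≤_; _<_; s≤s; z≤n)
import Data.Nat.DivMod as ℕ
import Data.Nat.Properties as ℕ
import Data.Nat.Solver as ℕSolver
open import Data.Product.Base using (∃-syntax; _×_; _,_; proj₁; proj₂)
open import Data.Sum.Base as Sum using (_⊎_; inj₁; inj₂)
open import Data.Vec.Functional using (replicate)
open import Function.Base using (_∘_)
open import Function.Bundles using (Inverse; _⇔_; mk⇔; Equivalence)
open import Relation.Binary.Definitions using (DecidableEquality)
open import Relation.Binary.PropositionalEquality hiding ([_])
open import Relation.Nullary.Decidable using (Dec; yes; no; _⊎-dec_)
open import Relation.Nullary.Negation using (¬_; contradiction)
open import Relation.Unary using (Pred; Decidable; _⊆_; _∪_; ｛_｝)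

-- The obstacle is an added point `P x₀ y₀` in Ψ: the affine lines that stand for the lines through
-- it are not concurrent, so a second point of Ω need not determine its line. With `d = y + y₀`,
-- incidence reads `d = m x + m^q x₀`. Its `q`-th power `d^q = m x₀^q + m^q x^q` is another linear
-- equation in `m` and `m^q`, and the determinant of the pair is `∥ x ∥ + u` with `u = ∥ x₀ ∥`; this
-- makes the norm `u` exceptional. Multiplying the second equation by `x₀ / x^q` turns it into the
-- incidence of the same `m` with the point `(u / x^q , x₀ d^q / x^q + y₀)`. This is the Baer image,
-- and it lies on every line of the family that passes through `(x , y)`. The image involves the
-- coordinates only through their `q`-th powers, which on the conic are rational functions of `τ^q`.
-- All bounds are injective codings of the parametrised conic points: a point of Φ is recorded by
-- its second point in Ψ, together with the slope when the added point is in Ψ.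

-- Finite fields: inverses, the characteristic, and the identity `x ^ n ≡ x`.

module FieldProperties {n : ℕ} (F : FiniteField n) where
  open FiniteField F
  open CommutativeRing commutativeRing public
    using ( +-comm; +-assoc; +-identityˡ; +-identityʳ; -‿inverseˡ; -‿inverseʳ
          ; *-comm; *-assoc; *-identityˡ; *-identityʳ; distribˡ; zeroˡ; zeroʳ
          ; commutativeSemiring; ring; semiring; +-commutativeMonoid; *-commutativeMonoid)
  open CExp commutativeSemiring public using (^-homo-*; ^-assocʳ; ^-distrib-*)
  private module ΣF = BigOp +-commutativeMonoid
  private module ΠF = BigOp *-commutativeMonoid
  open SMult semiring using (×1-homo-*) renaming (_×_ to _×#_)
  open Inverse enumeration using (to; from; strictlyInverseˡ; strictlyInverseʳ)
  open RingProps ring using () renaming (+-cancelˡ to cancelˡ)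

  from-injective : ∀ {x y} → from x ≡ from y → x ≡ y
  from-injective {x} {y} eq = trans (sym (strictlyInverseˡ x)) (trans (cong to eq) (strictlyInverseˡ y))

  to-injective : ∀ {i j} → to i ≡ to j → i ≡ j
  to-injective {i} {j} eq = trans (sym (strictlyInverseʳ i)) (trans (cong from eq) (strictlyInverseʳ j))

  infix 4 _≟_
  _≟_ : DecidableEquality Carrier
  x ≟ y with from x Fin.≟ from y
  ... | yes eq = yes (from-injective eq)
  ... | no neq = no (neq ∘ cong from)

  infix 8 _⁻¹
  abstract
    _⁻¹ : Carrier → Carrier
    x ⁻¹ with x ≟ 0#
    ... | yes _ = 0#
    ... | no x≢0 = proj₁ (inverse x x≢0)

    ⁻¹-inverseʳ : ∀ {x} → x ≢ 0# → x * x ⁻¹ ≡ 1#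
    ⁻¹-inverseʳ {x} x≢0 with x ≟ 0#
    ... | yes x≡0 = contradiction x≡0 x≢0
    ... | no x≢0 = proj₂ (inverse x x≢0)

  ⁻¹-inverseˡ : ∀ {x} → x ≢ 0# → x ⁻¹ * x ≡ 1#
  ⁻¹-inverseˡ x≢0 = trans (*-comm _ _) (⁻¹-inverseʳ x≢0)

  x*y⁻¹*y≡x : ∀ x {y} → y ≢ 0# → x * y ⁻¹ * y ≡ x
  x*y⁻¹*y≡x x y≢0 = trans (*-assoc x _ _) (trans (cong (x *_) (⁻¹-inverseˡ y≢0)) (*-identityʳ x))

  *-cancelˡ : ∀ {z x y} → z ≢ 0# → z * x ≡ z * y → x ≡ y
  *-cancelˡ {z} {x} {y} z≢0 eq = begin
    x                ≡⟨ *-identityˡ x ⟨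
    1# * x           ≡⟨ cong (_* x) (⁻¹-inverseˡ z≢0) ⟨
    z ⁻¹ * z * x     ≡⟨ *-assoc _ _ _ ⟩
    z ⁻¹ * (z * x)   ≡⟨ cong (z ⁻¹ *_) eq ⟩
    z ⁻¹ * (z * y)   ≡⟨ *-assoc _ _ _ ⟨
    z ⁻¹ * z * y     ≡⟨ cong (_* y) (⁻¹-inverseˡ z≢0) ⟩
    1# * y           ≡⟨ *-identityˡ y ⟩
    y                ∎
    where open ≡-Reasoning

  x*y≡0⇒y≡0 : ∀ {x y} → x ≢ 0# → x * y ≡ 0# → y ≡ 0#
  x*y≡0⇒y≡0 {x} x≢0 eq = *-cancelˡ x≢0 (trans eq (sym (zeroʳ x)))

  *-≢0 : ∀ {x y} → x ≢ 0# → y ≢ 0# → x * y ≢ 0#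
  *-≢0 x≢0 y≢0 eq = y≢0 (x*y≡0⇒y≡0 x≢0 eq)

  ⁻¹-≢0 : ∀ {x} → x ≢ 0# → x ⁻¹ ≢ 0#
  ⁻¹-≢0 {x} x≢0 eq = 0≢1 (trans (sym (trans (cong (x *_) eq) (zeroʳ x))) (⁻¹-inverseʳ x≢0))

  ^-≢0 : ∀ {x} k → x ≢ 0# → x ^ k ≢ 0#
  ^-≢0 zero    x≢0 eq = 0≢1 (sym eq)
  ^-≢0 (suc k) x≢0    = *-≢0 x≢0 (^-≢0 k x≢0)

  1^ : ∀ e → 1# ^ e ≡ 1#
  1^ zero    = refl
  1^ (suc e) = trans (*-identityˡ _) (1^ e)

  private
    bijection-permutation : (f g : Carrier → Carrier) → (∀ x → f (g x) ≡ x) → (∀ x → g (f x) ≡ x) →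
                            Permutation n n
    bijection-permutation f g fg gf = permutation (from ∘ f ∘ to) (from ∘ g ∘ to)
      (λ i → trans (cong (from ∘ f) (strictlyInverseˡ _)) (trans (cong from (fg _)) (strictlyInverseʳ i)))
      (λ i → trans (cong (from ∘ g) (strictlyInverseˡ _)) (trans (cong from (gf _)) (strictlyInverseʳ i)))

  -- Translation by `1#` permutes the field, so the sum of all elements does not change when `1#` is
  -- added to each of its `n` terms.
  n×1≡0 : n ×# 1# ≡ 0#
  n×1≡0 = cancelˡ (ΣF.sum to) _ _ (begin
    ΣF.sum to + n ×# 1#                           ≡⟨ cong (ΣF.sum to +_) (ΣF.sum-replicate n) ⟨
    ΣF.sum to + ΣF.sum (replicate n 1#)           ≡⟨ ΣF.∑-distrib-+ to (replicate n 1#) ⟨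
    ΣF.sum (λ i → to i + 1#)                      ≡⟨ ΣF.sum-cong-≗ (λ i → strictlyInverseˡ (to i + 1#)) ⟨
    ΣF.sum (λ i → to (π ⟨$⟩ʳ i))                  ≡⟨ ΣF.sum-permute to π ⟨
    ΣF.sum to                                     ≡⟨ +-identityʳ _ ⟨
    ΣF.sum to + 0#                                ∎)
    where
    open ≡-Reasoning
    π = bijection-permutation (_+ 1#) (_+ (- 1#))
      (λ x → trans (+-assoc _ _ _) (trans (cong (x +_) (-‿inverseˡ 1#)) (+-identityʳ x)))
      (λ x → trans (+-assoc _ _ _) (trans (cong (x +_) (-‿inverseʳ 1#)) (+-identityʳ x)))

  private
    -- Replacing 0 by 1 makes the product over all elements the product of the units.
    unit : Carrier → Carrier
    unit x with x ≟ 0#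
    ... | yes _ = 1#
    ... | no  _ = x

    unit≢0 : ∀ x → unit x ≢ 0#
    unit≢0 x with x ≟ 0#
    ... | yes _ = 0≢1 ∘ sym
    ... | no x≢0 = x≢0

    -- These split the constant `a` into two factors: one is absorbed by `unit` under multiplication
    -- by `a`, the other is the single surplus factor at 0.
    onUnits onZero : Carrier → Carrier → Carrier
    onUnits a x with x ≟ 0#
    ... | yes _ = 1#
    ... | no  _ = a
    onZero a x with x ≟ 0#
    ... | yes _ = a
    ... | no  _ = 1#

    onUnits*onZero : ∀ a x → onUnits a x * onZero a x ≡ a
    onUnits*onZero a x with x ≟ 0#
    ... | yes _ = *-identityˡ a
    ... | no  _ = *-identityʳ a

    unit-* : ∀ a x → a ≢ 0# → unit (a * x) ≡ onUnits a x * unit x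
    unit-* a x a≢0 with x ≟ 0# | (a * x) ≟ 0#
    ... | yes x≡0 | yes _   = sym (*-identityˡ 1#)
    ... | yes x≡0 | no ax≢0 = contradiction (trans (cong (a *_) x≡0) (zeroʳ a)) ax≢0
    ... | no x≢0  | yes eq  = contradiction eq (*-≢0 a≢0 x≢0)
    ... | no x≢0  | no _    = refl

    onZero-0 : ∀ a → onZero a 0# ≡ a
    onZero-0 a with 0# ≟ 0#
    ... | yes _ = refl
    ... | no 0≢0 = contradiction refl 0≢0

    onZero-≢0 : ∀ a {x} → x ≢ 0# → onZero a x ≡ 1#
    onZero-≢0 a {x} x≢0 with x ≟ 0#
    ... | yes eq = contradiction eq x≢0
    ... | no _ = refl

    Π≢0 : ∀ {m} (f : Fin m → Carrier) → (∀ i → f i ≢ 0#) → ΠF.sum f ≢ 0#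
    Π≢0 {zero}  f f≢0 eq = 0≢1 (sym eq)
    Π≢0 {suc m} f f≢0    = *-≢0 (f≢0 zero) (Π≢0 (f ∘ suc) (f≢0 ∘ suc))

    Π-constant-1 : ∀ {m} (f : Fin m → Carrier) → (∀ i → f i ≡ 1#) → ΠF.sum f ≡ 1#
    Π-constant-1 {m} f f≡1 = trans (ΠF.sum-cong-≗ f≡1) (ΠF.sum-replicate-zero m)

    Π-single : ∀ {m} (f : Fin m → Carrier) i → (∀ j → j ≢ i → f j ≡ 1#) → ΠF.sum f ≡ f i
    Π-single f zero    f≡1 =
      trans (cong (f zero *_) (Π-constant-1 (f ∘ suc) (λ j → f≡1 (suc j) λ ()))) (*-identityʳ _)
    Π-single f (suc i) f≡1 =
      trans (cong₂ _*_ (f≡1 zero λ ()) (Π-single (f ∘ suc) i (λ j j≢i → f≡1 (suc j) (j≢i ∘ Fin.suc-injective))))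
            (*-identityˡ _)

  -- Multiplication by `a` permutes the units and so preserves their product, hence the `n - 1`
  -- factors `a` placed at the units multiply to `1#`. The factor at 0 is left. Here `ΠF.sum` is a
  -- product, the sum of the multiplicative monoid.
  x^n≡x-≢0 : ∀ a → a ≢ 0# → a ^ n ≡ a
  x^n≡x-≢0 a a≢0 = begin
    a ^ n                                                     ≡⟨ ΠF.sum-replicate n ⟨
    ΠF.sum {n} (λ i → a)                                      ≡⟨ ΠF.sum-cong-≗ (λ i → onUnits*onZero a (to i)) ⟨
    ΠF.sum (λ i → onUnits a (to i) * onZero a (to i))         ≡⟨ ΠF.∑-distrib-+ (onUnits a ∘ to) (onZero a ∘ to) ⟩
    ΠF.sum (onUnits a ∘ to) * ΠF.sum (onZero a ∘ to)          ≡⟨ cong₂ _*_ Πunits≡1 Πzero≡a ⟩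
    1# * a                                                    ≡⟨ *-identityˡ a ⟩
    a                                                         ∎
    where
    open ≡-Reasoning
    π = bijection-permutation (a *_) (a ⁻¹ *_)
      (λ x → trans (sym (*-assoc _ _ _)) (trans (cong (_* x) (⁻¹-inverseʳ a≢0)) (*-identityˡ x)))
      (λ x → trans (sym (*-assoc _ _ _)) (trans (cong (_* x) (⁻¹-inverseˡ a≢0)) (*-identityˡ x)))
    Πzero≡a : ΠF.sum (onZero a ∘ to) ≡ a
    Πzero≡a = trans
      (Π-single (onZero a ∘ to) (from 0#)
        (λ j j≢ → onZero-≢0 a (λ eq → j≢ (trans (sym (strictlyInverseʳ j)) (cong from eq)))))
      (trans (cong (onZero a) (strictlyInverseˡ 0#)) (onZero-0 a))
    Πunits≡1 : ΠF.sum (onUnits a ∘ to) ≡ 1#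
    Πunits≡1 = *-cancelˡ (Π≢0 (unit ∘ to) (unit≢0 ∘ to)) (begin
      ΠF.sum (unit ∘ to) * ΠF.sum (onUnits a ∘ to)          ≡⟨ *-comm _ _ ⟩
      ΠF.sum (onUnits a ∘ to) * ΠF.sum (unit ∘ to)          ≡⟨ ΠF.∑-distrib-+ (onUnits a ∘ to) (unit ∘ to) ⟨
      ΠF.sum (λ i → onUnits a (to i) * unit (to i))         ≡⟨ ΠF.sum-cong-≗ (λ i → unit-* a (to i) a≢0) ⟨
      ΠF.sum (λ i → unit (a * to i))                        ≡⟨ ΠF.sum-cong-≗ (λ i → cong unit (strictlyInverseˡ (a * to i))) ⟨
      ΠF.sum (λ i → unit (to (π ⟨$⟩ʳ i)))                   ≡⟨ ΠF.sum-permute (unit ∘ to) π ⟨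
      ΠF.sum (unit ∘ to)                                    ≡⟨ *-identityʳ _ ⟨
      ΠF.sum (unit ∘ to) * 1#                               ∎)

  x^n≡x : ∀ a → a ^ n ≡ a
  x^n≡x a with a ≟ 0#
  ... | no a≢0 = x^n≡x-≢0 a a≢0
  ... | yes refl = 0^ n (from 0#)
    where
    0^ : ∀ m → Fin m → 0# ^ m ≡ 0#
    0^ (suc m) _ = zeroˡ _

  -- Adding up `2 ^ k` ones gives the `k`-th power of `1# + 1#`; a field has no nilpotent element
  -- but 0.
  characteristic-2 : ∀ k → n ≡ 2 ℕ.^ k → 1# + 1# ≡ 0#
  characteristic-2 k n≡2^k with (1# + 1#) ≟ 0#
  ... | yes eq = eq
  ... | no neq = contradiction (trans (sym (2^×1 k)) (subst (λ m → m ×# 1# ≡ 0#) n≡2^k n×1≡0)) (^-≢0 k neq)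
    where
    2^×1 : ∀ k → (2 ℕ.^ k) ×# 1# ≡ (1# + 1#) ^ k
    2^×1 zero    = +-identityʳ 1#
    2^×1 (suc k) = trans (×1-homo-* 2 (2 ℕ.^ k))
      (cong₂ _*_ (cong (1# +_) (+-identityʳ 1#)) (2^×1 k))

-- Counting with lists.

length-concatMap-≤ : ∀ {A B : Set} (f : A → List B) k xs → (∀ x → x ∈ xs → length (f x) ≤ k) →
                     length (concatMap f xs) ≤ k ℕ.* length xs
length-concatMap-≤ f k []       _  = z≤n
length-concatMap-≤ f k (x ∷ xs) f≤ = begin
  length (f x ++ concatMap f xs)          ≡⟨ length-++ (f x) ⟩
  length (f x) ℕ.+ length (concatMap f xs) ≤⟨ ℕ.+-mono-≤ (f≤ x (here refl)) (length-concatMap-≤ f k xs (λ y → f≤ y ∘ there)) ⟩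
  k ℕ.+ k ℕ.* length xs                   ≡⟨ ℕ.*-suc k (length xs) ⟨
  k ℕ.* suc (length xs)                   ∎
  where open ℕ.≤-Reasoning

length-≤2 : ∀ {A : Set} (xs : List A) → Unique xs →
            (∀ x y z → x ∈ xs → y ∈ xs → z ∈ xs → x ≢ y → x ≢ z → y ≢ z → ⊥) → length xs ≤ 2
length-≤2 []                 _ _ = z≤n
length-≤2 (_ ∷ [])           _ _ = s≤s z≤n
length-≤2 (_ ∷ _ ∷ [])       _ _ = s≤s (s≤s z≤n)
length-≤2 (x ∷ y ∷ z ∷ _) ((x≢y ∷ x≢z ∷ _) ∷ (y≢z ∷ _) ∷ _) no-three =
  ⊥-elim (no-three x y z (here refl) (there (here refl)) (there (there (here refl))) x≢y x≢z y≢z)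

module Enumeration {n : ℕ} (F : FiniteField n) where
  open FiniteField F
  open FieldProperties F
  open Inverse enumeration using (to; from; strictlyInverseˡ)

  elements-unique : Unique elements
  elements-unique = Unique.tabulate⁺ to-injective

  ∈-elements : ∀ x → x ∈ elements
  ∈-elements x = subst (_∈ elements) (strictlyInverseˡ x) (∈-tabulate⁺ (from x))

  module _ {ℓ} {P : Pred Carrier ℓ} (P? : Decidable P) where
    ∈-filter-elements : ∀ {x} → P x → x ∈ filter P? elements
    ∈-filter-elements = ∈-filter⁺ P? (∈-elements _)

    filter-elements-unique : Unique (filter P? elements)
    filter-elements-unique = Unique.filter⁺ P? elements-unique

    ∈-filter-elements⁻ : ∀ {x} → x ∈ filter P? elements → P x
    ∈-filter-elements⁻ x∈ = proj₂ (∈-filter⁻ P? {xs = elements} x∈)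

  -- The injection sends an element to the position of one chosen code. As coding is a relation, an
  -- element may have several codes and the list may contain repetitions.
  coding⇒≤ : ∀ {C : Set} (codes : List C) (R : Carrier → C → Set) →
             (∀ x → ∃[ c ] c ∈ codes × R x c) →
             (∀ x y c → R x c → R y c → x ≡ y) → n ≤ length codes
  coding⇒≤ codes R encode decode = Fin.injective⇒≤ {f = f} f-injective
    where
    f : Fin n → Fin (length codes)
    f i = index (proj₁ (proj₂ (encode (to i))))
    f-injective : ∀ {i j} → f i ≡ f j → i ≡ j
    f-injective {i} {j} eq with encode (to i) | encode (to j)
    ... | c , c∈ , Rc | d , d∈ , Rd = to-injective (decode _ _ d (subst (R (to i)) c≡d Rc) Rd)
      where
      c≡d : c ≡ d
      c≡d = trans (lookup-index c∈) (trans (cong (lookup codes) eq) (sym (lookup-index d∈)))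

-- Characteristic 2: Frobenius map, square roots, polynomial functions and their roots.

𝔽₂ : RawRing 0ℓ 0ℓ
𝔽₂ = record { Carrier = Bool ; _≈_ = _≡_ ; _+_ = _xor_ ; _*_ = _∧_ ; -_ = λ b → b ; 0# = false ; 1# = true }

module Characteristic2 {n : ℕ} (F : FiniteField n) (k : ℕ) (n≡ : n ≡ 2 ℕ.^ suc k) where
  open FiniteField F
  open FieldProperties F public
  open Enumeration F public

  1+1≡0 : 1# + 1# ≡ 0#
  1+1≡0 = characteristic-2 (suc k) n≡

  x+x≡0 : ∀ x → x + x ≡ 0#
  x+x≡0 x = begin
    x + x             ≡⟨ cong₂ _+_ (*-identityʳ x) (*-identityʳ x) ⟨
    x * 1# + x * 1#   ≡⟨ distribˡ x 1# 1# ⟨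
    x * (1# + 1#)     ≡⟨ cong (x *_) 1+1≡0 ⟩
    x * 0#            ≡⟨ zeroʳ x ⟩
    0#                ∎
    where open ≡-Reasoning

  private
    ⟦_⟧₂ : Bool → Carrier
    ⟦ false ⟧₂ = 0#
    ⟦ true ⟧₂  = 1#

    𝔽₂⟶F : 𝔽₂ -Raw-AlmostCommutative⟶ fromCommutativeRing commutativeRing
    𝔽₂⟶F = record
      { ⟦_⟧    = ⟦_⟧₂
      ; +-homo = λ { false y → sym (+-identityˡ _) ; true false → sym (+-identityʳ _) ; true true → sym 1+1≡0 }
      ; *-homo = λ { false y → sym (zeroˡ _) ; true y → sym (*-identityˡ _) }
      ; -‿homo = λ b → neg ⟦ b ⟧₂
      ; 0-homo = refl
      ; 1-homo = refl
      }
      where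
      neg : ∀ x → x ≡ - x
      neg x = begin
        x               ≡⟨ +-identityʳ x ⟨
        x + 0#          ≡⟨ cong (x +_) (-‿inverseʳ x) ⟨
        x + (x + - x)   ≡⟨ +-assoc x x (- x) ⟨
        x + x + - x     ≡⟨ cong (_+ - x) (x+x≡0 x) ⟩
        0# + - x        ≡⟨ +-identityˡ (- x) ⟩
        - x             ∎
        where open ≡-Reasoning

    _≟₂_ : ∀ a b → Maybe (⟦ a ⟧₂ ≡ ⟦ b ⟧₂)
    a ≟₂ b with a Bool.≟ b
    ... | yes eq = just (cong ⟦_⟧₂ eq)
    ... | no _   = nothing

  -- Deciding identities with coefficients in GF(2) lets the ring solver use 1 + 1 = 0.
  open RingSolver 𝔽₂ (fromCommutativeRing commutativeRing) 𝔽₂⟶F _≟₂_ public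
    using (solve; _:=_; _:+_; _:*_; _:-_; con; Polynomial)

  +≡0⇒≡ : ∀ {x y} → x + y ≡ 0# → x ≡ y
  +≡0⇒≡ {x} {y} eq = begin
    x           ≡⟨ solve 2 (λ x y → x := (x :+ y) :+ y) refl x y ⟩
    x + y + y   ≡⟨ cong (_+ y) eq ⟩
    0# + y      ≡⟨ +-identityˡ y ⟩
    y           ∎
    where open ≡-Reasoning

  ≡⇒+≡0 : ∀ {x y} → x ≡ y → x + y ≡ 0#
  ≡⇒+≡0 {x} refl = x+x≡0 x

  frobenius-+ : ∀ j x y → (x + y) ^ (2 ℕ.^ j) ≡ x ^ (2 ℕ.^ j) + y ^ (2 ℕ.^ j)
  frobenius-+ zero    x y = solve 2 (λ x y → (x :+ y) :* con true := x :* con true :+ y :* con true) refl x y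
  frobenius-+ (suc j) x y = begin
    (x + y) ^ (2 ℕ.* 2 ℕ.^ j)                            ≡⟨ ^-assocʳ (x + y) 2 (2 ℕ.^ j) ⟨
    ((x + y) ^ 2) ^ (2 ℕ.^ j)                            ≡⟨ cong (_^ (2 ℕ.^ j)) (solve 2 (λ x y →
      (x :+ y) :* ((x :+ y) :* con true) := x :* (x :* con true) :+ y :* (y :* con true)) refl x y) ⟩
    (x ^ 2 + y ^ 2) ^ (2 ℕ.^ j)                          ≡⟨ frobenius-+ j (x ^ 2) (y ^ 2) ⟩
    (x ^ 2) ^ (2 ℕ.^ j) + (y ^ 2) ^ (2 ℕ.^ j)            ≡⟨ cong₂ _+_ (^-assocʳ x 2 (2 ℕ.^ j)) (^-assocʳ y 2 (2 ℕ.^ j)) ⟩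
    x ^ (2 ℕ.* 2 ℕ.^ j) + y ^ (2 ℕ.* 2 ℕ.^ j)            ∎
    where open ≡-Reasoning

  abstract
    √ : Carrier → Carrier
    √ x = x ^ (2 ℕ.^ k)

    √*√ : ∀ x → √ x * √ x ≡ x
    √*√ x = begin
      x ^ (2 ℕ.^ k) * x ^ (2 ℕ.^ k)   ≡⟨ ^-homo-* x (2 ℕ.^ k) (2 ℕ.^ k) ⟨
      x ^ (2 ℕ.^ k ℕ.+ 2 ℕ.^ k)       ≡⟨ cong (λ m → x ^ (2 ℕ.^ k ℕ.+ m)) (ℕ.+-identityʳ (2 ℕ.^ k)) ⟨
      x ^ (2 ℕ.^ suc k)               ≡⟨ cong (x ^_) n≡ ⟨
      x ^ n                           ≡⟨ x^n≡x x ⟩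
      x                               ∎
      where open ≡-Reasoning


  x*x≡0⇒x≡0 : ∀ {x} → x * x ≡ 0# → x ≡ 0#
  x*x≡0⇒x≡0 {x} eq with x ≟ 0#
  ... | yes x≡0 = x≡0
  ... | no x≢0 = x*y≡0⇒y≡0 x≢0 eq

  square-injective : ∀ {x y} → x * x ≡ y * y → x ≡ y
  square-injective {x} {y} eq = +≡0⇒≡ (x*x≡0⇒x≡0 (begin
    (x + y) * (x + y)   ≡⟨ solve 2 (λ x y → (x :+ y) :* (x :+ y) := x :* x :+ y :* y) refl x y ⟩
    x * x + y * y       ≡⟨ ≡⇒+≡0 eq ⟩
    0#                  ∎))
    where open ≡-Reasoning

  -- f is given by a polynomial of formal degree d whose coefficient of x^d is c.
  Degree : ℕ → Carrier → (Carrier → Carrier) → Set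
  Degree zero    c f = ∀ x → f x ≡ c
  Degree (suc d) c f = ∃[ b ] ∃[ g ] Degree d c g × (∀ x → f x ≡ b + x * g x)

  degree-cong : ∀ d {c c′ f g} → c ≡ c′ → (∀ x → f x ≡ g x) → Degree d c f → Degree d c′ g
  degree-cong zero    refl f≗g f≗c               = λ x → trans (sym (f≗g x)) (f≗c x)
  degree-cong (suc d) refl f≗g (b , f′ , deg , eq) = b , f′ , deg , λ x → trans (sym (f≗g x)) (eq x)

  degree-* : ∀ d {c f} a → Degree d c f → Degree d (a * c) (λ x → a * f x)
  degree-* zero    a f≗c = λ x → cong (a *_) (f≗c x)
  degree-* (suc d) a (b , g , deg , eq) = a * b , (λ x → a * g x) , degree-* d a deg , λ x →
    trans (cong (a *_) (eq x)) (solve 4 (λ a b x g → a :* (b :+ x :* g) := a :* b :+ x :* (a :* g)) refl a b x (g x))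

  degree-+ : ∀ d {c c′ f g} → Degree d c f → Degree d c′ g → Degree d (c + c′) (λ x → f x + g x)
  degree-+ zero    f≗c g≗c = λ x → cong₂ _+_ (f≗c x) (g≗c x)
  degree-+ (suc d) (b , f , deg-f , f-eq) (b′ , g , deg-g , g-eq) =
    b + b′ , (λ x → f x + g x) , degree-+ d deg-f deg-g , λ x → trans (cong₂ _+_ (f-eq x) (g-eq x))
      (solve 5 (λ b b′ x f g → b :+ x :* f :+ (b′ :+ x :* g) := b :+ b′ :+ x :* (f :+ g)) refl b b′ x (f x) (g x))

  degree-pad : ∀ d {c f} → Degree d c f → Degree (suc d) 0# f
  degree-pad zero    {c} f≗c = c , (λ _ → 0#) , (λ _ → refl) , λ x →
    trans (f≗c x) (solve 2 (λ c x → c := c :+ x :* con false) refl c x)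
  degree-pad (suc d) (b , g , deg , eq) = b , g , degree-pad d deg , eq

  degree-pad* : ∀ e d {c f} → Degree d c f → Degree (suc e ℕ.+ d) 0# f
  degree-pad* zero    d deg = degree-pad d deg
  degree-pad* (suc e) d deg = degree-pad (suc e ℕ.+ d) (degree-pad* e d deg)

  degree-constant : ∀ d c → Degree (suc d) 0# (λ _ → c)
  degree-constant d c = subst (λ e → Degree e 0# (λ _ → c)) (ℕ.+-identityʳ (suc d)) (degree-pad* d 0 (λ _ → refl))

  degree-product : ∀ d e {c c′ f g} → Degree d c f → Degree e c′ g → Degree (d ℕ.+ e) (c * c′) (λ x → f x * g x)
  degree-product zero    e {g = g} f≗c deg-g =
    degree-cong e refl (λ x → cong (_* g x) (sym (f≗c x))) (degree-* e _ deg-g)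
  degree-product (suc d) e {c} {c′} {g = g} (b , f , deg-f , f-eq) deg-g =
    degree-cong (suc d ℕ.+ e) (+-identityˡ _)
      (λ x → trans (solve 4 (λ b g x f → b :* g :+ (con false :+ x :* (f :* g)) := (b :+ x :* f) :* g) refl b (g x) x (f x))
                   (cong (_* g x) (sym (f-eq x))))
      -- The term `b * g` is padded with zero coefficients up to the formal degree of the other
      -- term, so the leading coefficient comes out as `0# + c * c′`.
      (degree-+ (suc d ℕ.+ e) (degree-pad* d e (degree-* e b deg-g))
        (0# , _ , degree-product d e deg-f deg-g , λ x → refl))

  degree-^ : ∀ d → Degree d 1# (_^ d)
  degree-^ zero    = λ x → refl
  degree-^ (suc d) = 0# , _ , degree-^ d , λ x → sym (+-identityˡ _)

  HasDegree : ℕ → (Carrier → Carrier) → Set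
  HasDegree d f = ∃[ c ] Degree d c f

  hasDegree-+ : ∀ {d f g} → HasDegree d f → HasDegree d g → HasDegree d (λ x → f x + g x)
  hasDegree-+ {d} (_ , f) (_ , g) = _ , degree-+ d f g

  hasDegree-* : ∀ {d f} c → HasDegree d f → HasDegree d (λ x → c * f x)
  hasDegree-* {d} c (_ , f) = _ , degree-* d c f

  hasDegree-product : ∀ {d e f g} → HasDegree d f → HasDegree e g → HasDegree (d ℕ.+ e) (λ x → f x * g x)
  hasDegree-product {d} {e} (_ , f) (_ , g) = _ , degree-product d e f g

  degree-linear : ∀ e → 2 ≤ e → ∀ s t → Degree e 0# (λ m → s * m + t)
  degree-linear (suc (suc e)) (s≤s (s≤s z≤n)) s t = t , (λ _ → s) , degree-constant e s , λ m →
    solve 3 (λ s t m → s :* m :+ t := t :+ m :* s) refl s t m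

  -- Synthetic division by `x - r`, which in characteristic 2 is `x + r`; the quotient keeps the
  -- leading coefficient.
  degree-quotient : ∀ d {c f} → Degree (suc d) c f → ∀ r →
                    ∃[ g ] Degree d c g × (∀ x → f x ≡ f r + (x + r) * g x)
  degree-quotient zero {c} {f} (b , g , g≗c , eq) r = g , g≗c , λ x → begin
    f x                           ≡⟨ eq x ⟩
    b + x * g x                   ≡⟨ cong (λ z → b + x * z) (g≗c x) ⟩
    b + x * c                     ≡⟨ solve 4 (λ b x r c → b :+ x :* c := b :+ r :* c :+ (x :+ r) :* c) refl b x r c ⟩
    b + r * c + (x + r) * c       ≡⟨ cong₂ (λ y z → b + r * y + (x + r) * z) (g≗c r) (g≗c x) ⟨
    b + r * g r + (x + r) * g x   ≡⟨ cong (_+ (x + r) * g x) (eq r) ⟨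
    f r + (x + r) * g x           ∎
    where open ≡-Reasoning
  degree-quotient (suc d) {c} {f} (b , g , deg-g , eq) r with degree-quotient d deg-g r
  ... | q , deg-q , g-eq = (λ x → g r + x * q x) , (g r , q , deg-q , λ x → refl) , λ x → begin
    f x                                         ≡⟨ eq x ⟩
    b + x * g x                                 ≡⟨ cong (λ z → b + x * z) (g-eq x) ⟩
    b + x * (g r + (x + r) * q x)               ≡⟨ solve 5 (λ b x r gr qx →
      b :+ x :* (gr :+ (x :+ r) :* qx) := b :+ r :* gr :+ (x :+ r) :* (gr :+ x :* qx)) refl b x r (g r) (q x) ⟩
    b + r * g r + (x + r) * (g r + x * q x)     ≡⟨ cong (_+ (x + r) * (g r + x * q x)) (eq r) ⟨
    f r + (x + r) * (g r + x * q x)             ∎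
    where open ≡-Reasoning

  -- Dividing out one root leaves a quotient that vanishes at the others, until a constant with a
  -- root remains. The vanishing of `c` bounds the number of roots of polynomials with known leading
  -- coefficient; the vanishing of `f` serves when nothing is known about the coefficients.
  many-roots : ∀ d {c f} → Degree d c f → ∀ xs → Unique xs → All (λ x → f x ≡ 0#) xs → d < length xs →
               c ≡ 0# × (∀ x → f x ≡ 0#)
  many-roots zero    f≗c (r ∷ _) _ (root ∷ _) _ = trans (sym (f≗c r)) root , λ x → trans (f≗c x) (trans (sym (f≗c r)) root)
  many-roots (suc d) {c} {f} deg (r ∷ rs) (r≢ ∷ rs-unique) (root ∷ roots) (s≤s d<) with degree-quotient d deg r
  ... | g , deg-g , eq =
    let c≡0 , g≗0 = many-roots d deg-g rs rs-unique (All.map (λ { (r≢x , fx≡0) → g≡0 r≢x fx≡0 }) (All.zip (r≢ , roots))) d<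
    in c≡0 , λ x → trans (f≡ x) (trans (cong ((x + r) *_) (g≗0 x)) (zeroʳ _))
    where
    f≡ : ∀ x → f x ≡ (x + r) * g x
    f≡ x = trans (eq x) (trans (cong (_+ (x + r) * g x) root) (+-identityˡ _))
    g≡0 : ∀ {x} → r ≢ x → f x ≡ 0# → g x ≡ 0#
    g≡0 {x} r≢x fx≡0 = x*y≡0⇒y≡0 (λ x+r≡0 → r≢x (sym (+≡0⇒≡ x+r≡0))) (trans (sym (f≡ x)) fx≡0)

  roots-≤ : ∀ d {c f} → Degree d c f → c ≢ 0# → length (filter (λ x → f x ≟ 0#) elements) ≤ d
  roots-≤ d {f = f} deg c≢0 with length (filter (λ x → f x ≟ 0#) elements) ℕ.≤? d
  ... | yes ≤d = ≤d
  ... | no ≰d = contradiction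
    (proj₁ (many-roots d deg _ (filter-elements-unique (λ x → f x ≟ 0#))
      (All.tabulate (∈-filter-elements⁻ (λ x → f x ≟ 0#))) (ℕ.≰⇒> ≰d))) c≢0

-- The hyperoval in normal form: its intersections with lines and the parametrised conic.

module Hyperoval {n : ℕ} (F : FiniteField n) (k : ℕ) (n≡ : n ≡ 2 ℕ.^ suc k)
  (a h b X₀ Y₀ : FiniteField.Carrier F) where
  open FiniteField F
  open Characteristic2 F k n≡

  S : Carrier → Carrier → Carrier
  S X Y = a * (X * X) + h * (X * Y) + b * (Y * Y)

  IsAnisotropic : Set
  IsAnisotropic = ∀ X Y → S X Y ≡ 0# → X ≡ 0# × Y ≡ 0#

  -- The nucleus is the point where S vanishes, the conic the points where S = 1.
  On : Carrier × Carrier → Set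
  On (x , y) = S (x + X₀) (y + Y₀) ≡ 0# ⊎ S (x + X₀) (y + Y₀) ≡ 1#

  On? : ∀ P → Dec (On P)
  On? (x , y) = (S (x + X₀) (y + Y₀) ≟ 0#) ⊎-dec (S (x + X₀) (y + Y₀) ≟ 1#)

  -- The determinant of the direction and the difference of the two points, with the signs dropped.
  Parallel : Carrier × Carrier → Carrier × Carrier → Carrier × Carrier → Set
  Parallel (d , e) (x , y) (x′ , y′) = d * (y′ + y) + e * (x′ + x) ≡ 0#

  NonZero : Carrier × Carrier → Set
  NonZero (d , e) = ¬ (d ≡ 0# × e ≡ 0#)

  S-line : ∀ X Y d e t → S (X + t * d) (Y + t * e) ≡ S X Y + (t * (h * (X * e + Y * d)) + t * t * S d e)
  S-line X Y d e t = solve 8 (λ a h b X Y d e t →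
      let S = λ X Y → a :* (X :* X) :+ h :* (X :* Y) :+ b :* (Y :* Y) in
      S (X :+ t :* d) (Y :+ t :* e) := S X Y :+ (t :* (h :* (X :* e :+ Y :* d)) :+ t :* t :* S d e))
    refl a h b X Y d e t

  multiple : ∀ d e v w → NonZero (d , e) → d * v + e * w ≡ 0# → ∃[ t ] w ≡ t * d × v ≡ t * e
  multiple d e v w nz eq with d ≟ 0# | e ≟ 0#
  ... | yes d≡0 | yes e≡0 = ⊥-elim (nz (d≡0 , e≡0))
  ... | no d≢0  | _ = w * d ⁻¹ , sym (x*y⁻¹*y≡x w d≢0) , +≡0⇒≡ (begin
    v + w * d ⁻¹ * e                           ≡⟨ cong (_+ w * d ⁻¹ * e) (x*y⁻¹*y≡x v d≢0) ⟨
    v * d ⁻¹ * d + w * d ⁻¹ * e                ≡⟨ solve 5 (λ v w d e i → v :* i :* d :+ w :* i :* e := i :* (d :* v :+ e :* w)) refl v w d e (d ⁻¹) ⟩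
    d ⁻¹ * (d * v + e * w)                     ≡⟨ cong (d ⁻¹ *_) eq ⟩
    d ⁻¹ * 0#                                  ≡⟨ zeroʳ _ ⟩
    0#                                         ∎)
    where
    open ≡-Reasoning
  ... | yes d≡0 | no e≢0 = v * e ⁻¹ , +≡0⇒≡ (begin
    w + v * e ⁻¹ * d                           ≡⟨ cong (_+ v * e ⁻¹ * d) (x*y⁻¹*y≡x w e≢0) ⟨
    w * e ⁻¹ * e + v * e ⁻¹ * d                ≡⟨ solve 5 (λ v w d e i → w :* i :* e :+ v :* i :* d := i :* (d :* v :+ e :* w)) refl v w d e (e ⁻¹) ⟩
    e ⁻¹ * (d * v + e * w)                     ≡⟨ cong (e ⁻¹ *_) eq ⟩
    e ⁻¹ * 0#                                  ≡⟨ zeroʳ _ ⟩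
    0#                                         ∎) , sym (x*y⁻¹*y≡x v e≢0)
    where
    open ≡-Reasoning

  module _ (anisotropic : IsAnisotropic) where

    private
      Bit : Carrier → Set
      Bit z = z ≡ 0# ⊎ z ≡ 1#

      bit-+1 : ∀ {z} → Bit z → Bit (z + 1#)
      bit-+1 (inj₁ refl) = inj₂ (+-identityˡ 1#)
      bit-+1 (inj₂ refl) = inj₁ 1+1≡0

      bit-difference : ∀ {z w} → Bit z → Bit (z + w) → w ≢ 0# → w ≡ 1#
      bit-difference (inj₁ refl) (inj₁ eq) w≢0 = contradiction (trans (sym (+-identityˡ _)) eq) w≢0
      bit-difference (inj₁ refl) (inj₂ eq) w≢0 = trans (sym (+-identityˡ _)) eq
      bit-difference (inj₂ refl) (inj₁ eq) w≢0 = sym (+≡0⇒≡ eq)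
      bit-difference {w = w} (inj₂ refl) (inj₂ eq) w≢0 = contradiction
        (trans (solve 1 (λ w → w := con true :+ (con true :+ w)) refl w) (trans (cong (1# +_) eq) 1+1≡0)) w≢0

    -- Along the line `S` changes by `t * E + t * t * S d e`, where `E = h * (X * e + Y * d)` is the
    -- polar form of start and direction. If `E` is 0, every nonzero `t` gives a nonzero change,
    -- which must be 1, and squaring is bijective: this is a line through the nucleus. Otherwise the
    -- line misses the nucleus, so `S` stays at 1 and `t = E / S d e` is forced.
    second-parameter : ∀ X Y d e → Bit (S X Y) → NonZero (d , e) →
      ∃[ τ ] τ ≢ 0# × Bit (S (X + τ * d) (Y + τ * e)) ×
             (∀ t → t ≢ 0# → Bit (S (X + t * d) (Y + t * e)) → t ≡ τ)
    second-parameter X Y d e on nz with h * (X * e + Y * d) ≟ 0#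
    ... | yes E≡0 = τ , τ≢0 ,
      subst Bit (sym (trans (line τ) (cong (S X Y +_) τ²s≡1))) (bit-+1 on) ,
      λ t t≢0 on-t → square-injective (*-cancelˡ s≢0 (trans (*-comm s _) (trans
        (trans (bit-difference on (subst Bit (line t) on-t) (*-≢0 (*-≢0 t≢0 t≢0) s≢0)) (sym τ²s≡1)) (*-comm _ s))))
      where
      s = S d e
      s≢0 : s ≢ 0#
      s≢0 = nz ∘ anisotropic d e
      τ = √ (s ⁻¹)
      τ²s≡1 : τ * τ * s ≡ 1#
      τ²s≡1 = trans (cong (_* s) (√*√ (s ⁻¹))) (⁻¹-inverseˡ s≢0)
      τ≢0 : τ ≢ 0#
      τ≢0 eq = ⁻¹-≢0 s≢0 (trans (sym (√*√ _)) (trans (cong (τ *_) eq) (zeroʳ τ)))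
      line : ∀ t → S (X + t * d) (Y + t * e) ≡ S X Y + t * t * s
      line t = trans (S-line X Y d e t) (cong (S X Y +_)
        (trans (cong (_+ t * t * s) (trans (cong (t *_) E≡0) (zeroʳ t))) (+-identityˡ _)))
    ... | no E≢0 = τ , *-≢0 E≢0 (⁻¹-≢0 s≢0) , subst Bit (sym line-τ) on ,
      λ t t≢0 on-t → *-cancelˡ s≢0 (trans (s*t≡E t t≢0 on-t) (sym s*τ≡E))
      where
      E = h * (X * e + Y * d)
      s = S d e
      s≢0 : s ≢ 0#
      s≢0 = nz ∘ anisotropic d e
      τ = E * s ⁻¹
      s*τ≡E : s * τ ≡ E
      s*τ≡E = trans (solve 3 (λ s E i → s :* (E :* i) := E :* (i :* s)) refl s E (s ⁻¹))
        (trans (cong (E *_) (⁻¹-inverseˡ s≢0)) (*-identityʳ E))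
      line : ∀ t → S (X + t * d) (Y + t * e) ≡ S X Y + t * (E + s * t)
      line t = trans (S-line X Y d e t) (cong (S X Y +_)
        (solve 3 (λ t E s → t :* E :+ t :* t :* s := t :* (E :+ s :* t)) refl t E s))
      line-τ : S (X + τ * d) (Y + τ * e) ≡ S X Y
      line-τ = trans (line τ) (trans (cong (λ z → S X Y + τ * z) (≡⇒+≡0 (sym s*τ≡E)))
        (solve 2 (λ σ τ → σ :+ τ :* con false := σ) refl (S X Y) τ))
      -- The line misses the nucleus because E ≢ 0.
      not-nucleus : ∀ t → S (X + t * d) (Y + t * e) ≢ 0#
      not-nucleus t eq = E≢0 (let X≡ , Y≡ = anisotropic _ _ eq in begin
        h * (X * e + Y * d)              ≡⟨ cong₂ (λ X Y → h * (X * e + Y * d)) (+≡0⇒≡ X≡) (+≡0⇒≡ Y≡) ⟩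
        h * (t * d * e + t * e * d)      ≡⟨ solve 4 (λ h t d e → h :* (t :* d :* e :+ t :* e :* d) := con false) refl h t d e ⟩
        0#                               ∎)
        where open ≡-Reasoning
      on-conic : ∀ t → Bit (S (X + t * d) (Y + t * e)) → S (X + t * d) (Y + t * e) ≡ 1#
      on-conic t (inj₁ eq) = contradiction eq (not-nucleus t)
      on-conic t (inj₂ eq) = eq
      S≡1 : S X Y ≡ 1#
      S≡1 = subst (λ z → z ≡ 1#) line-τ (on-conic τ (subst Bit (sym line-τ) on))
      s*t≡E : ∀ t → t ≢ 0# → Bit (S (X + t * d) (Y + t * e)) → s * t ≡ E
      s*t≡E t t≢0 on-t = sym (+≡0⇒≡ (x*y≡0⇒y≡0 t≢0 (begin
        t * (E + s * t)                     ≡⟨ solve 2 (λ σ z → z := σ :+ (σ :+ z)) refl (S X Y) (t * (E + s * t)) ⟩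
        S X Y + (S X Y + t * (E + s * t))   ≡⟨ cong (S X Y +_) (line t) ⟨
        S X Y + S (X + t * d) (Y + t * e)   ≡⟨ cong₂ _+_ S≡1 (on-conic t on-t) ⟩
        1# + 1#                             ≡⟨ 1+1≡0 ⟩
        0#                                  ∎)))
        where open ≡-Reasoning

    abstract
      second : ∀ {D P} → NonZero D → On P →
        ∃[ R ] On R × R ≢ P × Parallel D P R × (∀ R′ → On R′ → R′ ≢ P → Parallel D P R′ → R′ ≡ R)
      second {d , e} {x , y} nz on with second-parameter (x + X₀) (y + Y₀) d e on nz
      ... | τ , τ≢0 , on-τ , unique = (x + τ * d , y + τ * e)
        , subst Bit (cong₂ S (swap x d X₀ τ) (swap y e Y₀ τ)) on-τ
        , (λ eq → nz ( x*y≡0⇒y≡0 τ≢0 (no-move x d (cong proj₁ eq))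
                     , x*y≡0⇒y≡0 τ≢0 (no-move y e (cong proj₂ eq)) ))
        , solve 5 (λ x y d e τ → d :* (y :+ τ :* e :+ y) :+ e :* (x :+ τ :* d :+ x) := con false) refl x y d e τ
        , unique-point
        where
        swap : ∀ x d X τ → x + X + τ * d ≡ x + τ * d + X
        swap = solve 4 (λ x d X τ → x :+ X :+ τ :* d := x :+ τ :* d :+ X) refl
        no-move : ∀ x d → x + τ * d ≡ x → τ * d ≡ 0#
        no-move x d eq = trans (solve 2 (λ x z → z := x :+ z :+ x) refl x (τ * d)) (≡⇒+≡0 eq)
        unique-point : ∀ R′ → On R′ → R′ ≢ (x , y) → Parallel (d , e) (x , y) R′ → R′ ≡ (x + τ * d , y + τ * e)
        unique-point (x′ , y′) on′ R′≢P par with multiple d e (y′ + y) (x′ + x) nz par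
        ... | t , w≡ , v≡ = trans R′≡ (cong (λ t → x + t * d , y + t * e) t≡τ)
          where
          shift : ∀ x x′ z → x′ + x ≡ z → x′ ≡ x + z
          shift x x′ z eq = trans (solve 2 (λ x x′ → x′ := x :+ (x′ :+ x)) refl x x′) (cong (x +_) eq)
          R′≡ : (x′ , y′) ≡ (x + t * d , y + t * e)
          R′≡ = cong₂ _,_ (shift x x′ _ w≡) (shift y y′ _ v≡)
          still : ∀ x d → 0# ≡ t → x + t * d ≡ x
          still x d refl = solve 2 (λ x d → x :+ con false :* d := x) refl x d
          t≢0 : t ≢ 0#
          t≢0 t≡0 = R′≢P (trans R′≡ (cong₂ _,_ (still x d (sym t≡0)) (still y e (sym t≡0))))
          t≡τ : t ≡ τ
          t≡τ = unique t t≢0 (subst Bit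
            (trans (cong₂ (λ x y → S (x + X₀) (y + Y₀)) (cong proj₁ R′≡) (cong proj₂ R′≡))
              (cong₂ S (sym (swap x d X₀ t)) (sym (swap y e Y₀ t)))) on′)

    at-most-two : ∀ {D P R R′} → NonZero D → On P → On R → On R′ → R ≢ P → R′ ≢ P →
                  Parallel D P R → Parallel D P R′ → R ≡ R′
    at-most-two nz on on-R on-R′ R≢P R′≢P par par′ = let _ , _ , _ , _ , unique = second nz on in
      trans (unique _ on-R R≢P par) (sym (unique _ on-R′ R′≢P par′))

    -- Squaring is additive, so a square root of `S 1# (τ * τ)` is obtained coefficient by
    -- coefficient. Directions are written `(1 , τ²)` because then this root is a polynomial in `τ`.
    p : Carrier → Carrier
    p τ = √ a + √ h * τ + √ b * (τ * τ)

    p*p : ∀ τ → p τ * p τ ≡ S 1# (τ * τ)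
    p*p τ = begin
      p τ * p τ                                                             ≡⟨ solve 4 (λ a h b τ →
        (a :+ h :* τ :+ b :* (τ :* τ)) :* (a :+ h :* τ :+ b :* (τ :* τ))
          := a :* a :* (con true :* con true) :+ h :* h :* (con true :* (τ :* τ)) :+ b :* b :* (τ :* τ :* (τ :* τ)))
        refl (√ a) (√ h) (√ b) τ ⟩
      √ a * √ a * (1# * 1#) + √ h * √ h * (1# * (τ * τ)) + √ b * √ b * (τ * τ * (τ * τ))
        ≡⟨ cong₂ _+_ (cong₂ (λ a h → a * (1# * 1#) + h * (1# * (τ * τ))) (√*√ a) (√*√ h)) (cong (_* (τ * τ * (τ * τ))) (√*√ b)) ⟩
      S 1# (τ * τ)                                                          ∎
      where open ≡-Reasoning

    p≢0 : ∀ τ → p τ ≢ 0#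
    p≢0 τ eq = 0≢1 (sym (proj₁ (anisotropic 1# (τ * τ) (trans (sym (p*p τ)) (trans (cong (p τ *_) eq) (zeroʳ _))))))

    S-scale : ∀ c X Y → S (c * X) (c * Y) ≡ c * c * S X Y
    S-scale c X Y = solve 6 (λ a h b c X Y →
      a :* (c :* X :* (c :* X)) :+ h :* (c :* X :* (c :* Y)) :+ b :* (c :* Y :* (c :* Y))
        := c :* c :* (a :* (X :* X) :+ h :* (X :* Y) :+ b :* (Y :* Y))) refl a h b c X Y

    -- On the line through the nucleus with direction `(1 , τ²)`, scaling by `c` multiplies `S` by
    -- `c * c`; the factor `1 / p τ` brings the value to 1.
    conicPoint : Carrier → Carrier × Carrier
    conicPoint τ = p τ ⁻¹ + X₀ , p τ ⁻¹ * (τ * τ) + Y₀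

    private
      uncentre : ∀ x c → x + c + c ≡ x
      uncentre = solve 2 (λ x c → x :+ c :+ c := x) refl

    conicPoint-S : ∀ τ → S (proj₁ (conicPoint τ) + X₀) (proj₂ (conicPoint τ) + Y₀) ≡ 1#
    conicPoint-S τ = begin
      S (i + X₀ + X₀) (i * (τ * τ) + Y₀ + Y₀)     ≡⟨ cong₂ S (uncentre _ X₀) (uncentre _ Y₀) ⟩
      S i (i * (τ * τ))                           ≡⟨ cong (λ z → S z (i * (τ * τ))) (*-identityʳ i) ⟨
      S (i * 1#) (i * (τ * τ))                    ≡⟨ S-scale i 1# (τ * τ) ⟩
      i * i * S 1# (τ * τ)                        ≡⟨ cong (i * i *_) (p*p τ) ⟨
      i * i * (p τ * p τ)                         ≡⟨ solve 2 (λ i p → i :* i :* (p :* p) := (i :* p) :* (i :* p)) refl i (p τ) ⟩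
      (i * p τ) * (i * p τ)                       ≡⟨ cong₂ _*_ (⁻¹-inverseˡ (p≢0 τ)) (⁻¹-inverseˡ (p≢0 τ)) ⟩
      1# * 1#                                     ≡⟨ *-identityˡ 1# ⟩
      1#                                          ∎
      where
      open ≡-Reasoning
      i = p τ ⁻¹

    conicPoint-on : ∀ τ → On (conicPoint τ)
    conicPoint-on τ = inj₂ (conicPoint-S τ)

    private
      +-cancelʳ : ∀ {x y} c → x + c ≡ y + c → x ≡ y
      +-cancelʳ {x} {y} c eq = trans (sym (uncentre x c)) (trans (cong (_+ c) eq) (uncentre y c))

    conicPoint-injective : ∀ {σ τ} → conicPoint σ ≡ conicPoint τ → σ ≡ τ
    conicPoint-injective {σ} {τ} eq = square-injective (*-cancelˡ (⁻¹-≢0 (p≢0 σ))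
      (trans (+-cancelʳ Y₀ (cong proj₂ eq)) (cong (_* (τ * τ)) (sym (+-cancelʳ X₀ (cong proj₁ eq))))))

    -- Slopes from the nucleus miss only the nucleus itself and the vertical line through it, on
    -- which the conic has the single point with `b * (Y * Y) ≡ 1#`.
    on-classification : ∀ P → On P →
      P ≡ (X₀ , Y₀) ⊎ P ≡ (X₀ , √ (b ⁻¹) + Y₀) ⊎ ∃[ τ ] P ≡ conicPoint τ
    on-classification (x , y) (inj₁ eq) = inj₁ (let X≡0 , Y≡0 = anisotropic _ _ eq in cong₂ _,_ (+≡0⇒≡ X≡0) (+≡0⇒≡ Y≡0))
    on-classification (x , y) (inj₂ eq) with (x + X₀) ≟ 0#
    ... | yes X≡0 = inj₂ (inj₁ (cong₂ _,_ (+≡0⇒≡ X≡0) (trans (sym (uncentre y Y₀)) (cong (_+ Y₀) Y≡))))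
      where
      b≢0 : b ≢ 0#
      b≢0 b≡0 = 0≢1 (sym (proj₂ (anisotropic 0# 1# (trans (cong (λ b → a * (0# * 0#) + h * (0# * 1#) + b * (1# * 1#)) b≡0)
        (solve 2 (λ a h → a :* (con false :* con false) :+ h :* (con false :* con true) :+ con false :* (con true :* con true) := con false) refl a h)))))
      Y = y + Y₀
      bY²≡1 : b * (Y * Y) ≡ 1#
      bY²≡1 = trans (solve 4 (λ a h b Y → b :* (Y :* Y) := a :* (con false :* con false) :+ h :* (con false :* Y) :+ b :* (Y :* Y)) refl a h b Y)
        (trans (cong (λ X → S X Y) (sym X≡0)) eq)
      Y≡ : Y ≡ √ (b ⁻¹)
      Y≡ = square-injective (*-cancelˡ b≢0 (trans bY²≡1 (sym (trans (cong (b *_) (√*√ (b ⁻¹))) (⁻¹-inverseʳ b≢0)))))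
    ... | no X≢0 = inj₂ (inj₂ (τ , cong₂ _,_
        (trans (sym (uncentre x X₀)) (cong (_+ X₀) X≡))
        (trans (sym (uncentre y Y₀)) (cong (_+ Y₀) (trans Y≡ (cong (_* (τ * τ)) X≡))))))
      where
      X = x + X₀
      Y = y + Y₀
      τ = √ (Y * X ⁻¹)
      Y≡ : Y ≡ X * (τ * τ)
      Y≡ = sym (trans (cong (X *_) (√*√ _)) (trans
        (solve 3 (λ X Y i → X :* (Y :* i) := Y :* (i :* X)) refl X Y (X ⁻¹))
        (trans (cong (Y *_) (⁻¹-inverseˡ X≢0)) (*-identityʳ Y))))
      Xp≡1 : p τ * X ≡ 1#
      Xp≡1 = square-injective (begin
        p τ * X * (p τ * X)               ≡⟨ solve 2 (λ p X → p :* X :* (p :* X) := X :* X :* (p :* p)) refl (p τ) X ⟩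
        X * X * (p τ * p τ)               ≡⟨ cong (X * X *_) (p*p τ) ⟩
        X * X * S 1# (τ * τ)              ≡⟨ S-scale X 1# (τ * τ) ⟨
        S (X * 1#) (X * (τ * τ))          ≡⟨ cong₂ S (*-identityʳ X) (sym Y≡) ⟩
        S X Y                             ≡⟨ eq ⟩
        1#                                ≡⟨ *-identityˡ 1# ⟨
        1# * 1#                           ∎)
        where open ≡-Reasoning
      X≡ : X ≡ p τ ⁻¹
      X≡ = *-cancelˡ (p≢0 τ) (trans Xp≡1 (sym (⁻¹-inverseʳ (p≢0 τ))))

-- From a conic and its nucleus in the projective plane to the normal form.

module Projective {n : ℕ} (F : FiniteField n) (k : ℕ) (n≡ : n ≡ 2 ℕ.^ suc k) where
  open FiniteField F
  open Characteristic2 F k n≡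
  open ProjectivePlane F
  open QuadraticForm using (eval; polar)

  triple : ∀ {x y z x′ y′ z′ : Carrier} → x ≡ x′ → y ≡ y′ → z ≡ z′ → (x , y , z) ≡ (x′ , y′ , z′)
  triple refl refl refl = refl

  1·v≡v : ∀ v → v ≡ 1# · v
  1·v≡v v = triple (sym (*-identityˡ _)) (sym (*-identityˡ _)) (sym (*-identityˡ _))

  module ConicNucleus (a b c f g h : Carrier) (nondegenerate : NonDegenerate (quadraticForm a b c f g h)) where
    Q = quadraticForm a b c f g h

    -- The radical of the polar form, which in characteristic 2 is det (ν , v , w).
    ν : Vec₃
    ν = f , g , h

    polar-ν : ∀ w → polar Q ν w ≡ 0#
    polar-ν (x , y , z) = solve 9 (λ a b c f g h x y z →
      let ev = λ x y z → a :* (x :* x) :+ b :* (y :* y) :+ c :* (z :* z) :+ f :* (y :* z) :+ g :* (x :* z) :+ h :* (x :* y) in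
      ev (f :+ x) (g :+ y) (h :+ z) :- ev f g h :- ev x y z := con false) refl a b c f g h x y z

    combination : ∀ s t v → eval Q ((s · ν) ⊕ (t · v)) ≡ s * s * eval Q ν + t * t * eval Q v
    combination s t (x , y , z) = solve 11 (λ a b c f g h x y z s t →
      let ev = λ x y z → a :* (x :* x) :+ b :* (y :* y) :+ c :* (z :* z) :+ f :* (y :* z) :+ g :* (x :* z) :+ h :* (x :* y) in
      ev (s :* f :+ t :* x) (s :* g :+ t :* y) (s :* h :+ t :* z) := s :* s :* ev f g h :+ t :* t :* ev x y z)
      refl a b c f g h x y z s t

    scale : ∀ t v → eval Q (t · v) ≡ t * t * eval Q v
    scale t (x , y , z) = solve 10 (λ a b c f g h x y z t →
      let ev = λ x y z → a :* (x :* x) :+ b :* (y :* y) :+ c :* (z :* z) :+ f :* (y :* z) :+ g :* (x :* z) :+ h :* (x :* y) in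
      ev (t :* x) (t :* y) (t :* z) := t :* t :* ev x y z)
      refl a b c f g h x y z t

    -- Otherwise the form is the square of a linear form.
    ν≢𝟎 : ν ≢ 𝟎
    ν≢𝟎 refl = 0≢1 (sym (cong proj₁ (nondegenerate (1# , 0# , 0#)
        (trans (solve 3 (λ a b c → let ev = diagonal a b c in ev (con true) (con false) (con false) := a) refl a b c) a≡0)
        (polar≡0 (1# , 0# , 0#)))))
      where
      diagonal : ∀ {m} (a b c x y z : Polynomial m) → Polynomial m
      diagonal a b c x y z = a :* (x :* x) :+ b :* (y :* y) :+ c :* (z :* z)
        :+ con false :* (y :* z) :+ con false :* (x :* z) :+ con false :* (x :* y)
      polar≡0 : ∀ v w → polar Q v w ≡ 0#
      polar≡0 (x , y , z) (x′ , y′ , z′) = solve 9 (λ a b c x y z x′ y′ z′ →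
        diagonal a b c (x :+ x′) (y :+ y′) (z :+ z′) :- diagonal a b c x y z :- diagonal a b c x′ y′ z′ := con false)
        refl a b c x y z x′ y′ z′
      -- The form is now `a x² + b y² + c z²` with zero polar form, so by non-degeneracy it has only
      -- the trivial zero. The vector is chosen so that its value is `a * b + b * a`.
      v≡0 : (√ b , √ a , 0#) ≡ 𝟎
      v≡0 = nondegenerate (√ b , √ a , 0#)
        (begin
          eval Q (√ b , √ a , 0#)            ≡⟨ solve 5 (λ a b c √a √b → diagonal a b c √b √a (con false) := a :* (√b :* √b) :+ b :* (√a :* √a)) refl a b c (√ a) (√ b) ⟩
          a * (√ b * √ b) + b * (√ a * √ a)  ≡⟨ cong₂ (λ s t → a * s + b * t) (√*√ b) (√*√ a) ⟩
          a * b + b * a                      ≡⟨ ≡⇒+≡0 (*-comm a b) ⟩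
          0#                                 ∎)
        (polar≡0 _)
        where open ≡-Reasoning
      a≡0 : a ≡ 0#
      a≡0 = trans (sym (√*√ a)) (trans (cong (√ a *_) (cong (proj₁ ∘ proj₂) v≡0)) (zeroʳ _))

    evalν≢0 : eval Q ν ≢ 0#
    evalν≢0 eq = ν≢𝟎 (nondegenerate ν eq polar-ν)

    -- As `ν` lies in the radical, the form at `s ν + t v` is `s² Q(ν) + t² Q(v)`. Both sides of the
    -- relation vanish apart from `s² Q(ν)`, and `Q(ν)` is nonzero. Geometrically, a line through
    -- `ν` meets the conic only once.
    off-conic : ∀ s t r v w → eval Q v ≡ 0# → eval Q w ≡ 0# → r · w ≡ (s · ν) ⊕ (t · v) → s ≡ 0#
    off-conic s t r v w Qv Qw eq = x*x≡0⇒x≡0 (x*y≡0⇒y≡0 evalν≢0 (trans (*-comm _ _) (begin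
      s * s * eval Q ν                         ≡⟨ +-identityʳ _ ⟨
      s * s * eval Q ν + 0#                    ≡⟨ cong (s * s * eval Q ν +_) (trans (cong (t * t *_) Qv) (zeroʳ _)) ⟨
      s * s * eval Q ν + t * t * eval Q v      ≡⟨ combination s t v ⟨
      eval Q ((s · ν) ⊕ (t · v))               ≡⟨ cong (eval Q) eq ⟨
      eval Q (r · w)                           ≡⟨ scale r w ⟩
      r * r * eval Q w                         ≡⟨ trans (cong (r * r *_) Qw) (zeroʳ _) ⟩
      0#                                       ∎)))
      where open ≡-Reasoning

    -- The line joining `ν` to the point: their cross product without signs. Its coordinates are
    -- also the coefficients of the polar form with the point as one argument.
    tangent : Vec₃ → Vec₃
    tangent (x , y , z) = g * z + h * y , f * z + h * x , f * y + g * x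

    -- If the cross product vanished, `f · v`, `g · v` and `h · v` would be the multiples of `ν` by
    -- `x`, `y` and `z`, and `off-conic` makes each of these coordinates 0.
    tangent≢𝟎 : ∀ v → v ≢ 𝟎 → eval Q v ≡ 0# → tangent v ≢ 𝟎
    tangent≢𝟎 v@(x , y , z) v≢𝟎 Qv eq = v≢𝟎 (triple
        (zero-by x f (same x f) (trans (+≡0⇒≡ (cong (proj₂ ∘ proj₂) eq)) (*-comm g x))
                             (trans (+≡0⇒≡ (cong (proj₁ ∘ proj₂) eq)) (*-comm h x)))
        (zero-by y g gx (same y g) (trans (+≡0⇒≡ (cong proj₁ eq)) (*-comm h y)))
        (zero-by z h hx hy (same z h)))
      where
      same : ∀ x f → f * x ≡ x * f
      same x f = *-comm f x
      hy : h * y ≡ z * g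
      hy = trans (sym (+≡0⇒≡ (cong proj₁ eq))) (*-comm g z)
      hx : h * x ≡ z * f
      hx = trans (sym (+≡0⇒≡ (cong (proj₁ ∘ proj₂) eq))) (*-comm f z)
      gx : g * x ≡ y * f
      gx = trans (sym (+≡0⇒≡ (cong (proj₂ ∘ proj₂) eq))) (*-comm f y)
      zero-by : ∀ s r → r * x ≡ s * f → r * y ≡ s * g → r * z ≡ s * h → s ≡ 0#
      zero-by s r e₁ e₂ e₃ = off-conic s 0# r v v Qv Qv (triple (pad e₁) (pad e₂) (pad e₃))
        where
        pad : ∀ {u w x} → u ≡ w → u ≡ w + 0# * x
        pad {u} {w} {x} e = trans e (solve 2 (λ w x → w := w :+ con false :* x) refl w x)

    -- A point of the line joining `ν` and `v` is a combination of both; for a point of the conic,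
    -- `off-conic` removes the `ν` part.
    tangent-isTangent : ∀ (P : PGPoint) (Qv : Conic Q P) →
      IsTangent Q (tangent (proj₁ P) , tangent≢𝟎 (proj₁ P) (proj₂ P) Qv)
    tangent-isTangent P@(v@(p₁ , p₂ , p₃) , v≢𝟎) Qv = P , Qv , incident , only
      where
      incident : P on (tangent v , tangent≢𝟎 v v≢𝟎 Qv)
      incident = solve 6 (λ f g h x y z →
        (g :* z :+ h :* y) :* x :+ (f :* z :+ h :* x) :* y :+ (f :* y :+ g :* x) :* z := con false) refl f g h p₁ p₂ p₃
      multiple : ∀ r s t w → w ≢ 𝟎 → eval Q w ≡ 0# → r ≢ 0# → r · w ≡ (s · ν) ⊕ (t · v) → ∃[ u ] u ≢ 0# × w ≡ u · v
      multiple r s t w@(x , y , z) w≢𝟎 Qw r≢0 eq = r ⁻¹ * t , u≢0 , w≡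
        where
        s≡0 = off-conic s t r v w Qv Qw eq
        component : ∀ {x f p} → r * x ≡ s * f + t * p → x ≡ r ⁻¹ * t * p
        component {x} {f} {p} e = *-cancelˡ r≢0 (begin
          r * x                  ≡⟨ e ⟩
          s * f + t * p          ≡⟨ cong (λ s → s * f + t * p) s≡0 ⟩
          0# * f + t * p         ≡⟨ solve 2 (λ f tp → con false :* f :+ tp := con true :* tp) refl f (t * p) ⟩
          1# * (t * p)           ≡⟨ cong (_* (t * p)) (⁻¹-inverseʳ r≢0) ⟨
          r * r ⁻¹ * (t * p)     ≡⟨ solve 4 (λ r i t p → r :* i :* (t :* p) := r :* (i :* t :* p)) refl r (r ⁻¹) t p ⟩
          r * (r ⁻¹ * t * p)     ∎)
          where open ≡-Reasoning
        w≡ : w ≡ (r ⁻¹ * t) · v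
        w≡ = triple (component (cong proj₁ eq)) (component (cong (proj₁ ∘ proj₂) eq)) (component (cong (proj₂ ∘ proj₂) eq))
        u≢0 : r ⁻¹ * t ≢ 0#
        u≢0 u≡0 = w≢𝟎 (trans w≡ (trans (cong (_· v) u≡0) (triple (zeroˡ _) (zeroˡ _) (zeroˡ _))))
      -- The linear relation between ν, v, w and the i-th unit vector, whose last coefficient is det (ν , v , w).
      only : ∀ P′ → Conic Q P′ → P′ on (tangent v , tangent≢𝟎 v v≢𝟎 Qv) → P′ ∼ P
      only (w@(x , y , z) , w≢𝟎) Qw on with ℓ₁ ≟ 0# | ℓ₂ ≟ 0# | ℓ₃ ≟ 0#
        where
        ℓ₁ = g * p₃ + h * p₂
        ℓ₂ = f * p₃ + h * p₁
        ℓ₃ = f * p₂ + g * p₁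
      ... | no ℓ₁≢0 | _ | _ = multiple _ (p₂ * z + p₃ * y) (g * z + h * y) w w≢𝟎 Qw ℓ₁≢0 (triple
        (trans (solve 9 (λ f g h p₁ p₂ p₃ x y z → (g :* p₃ :+ h :* p₂) :* x :=
            ((g :* p₃ :+ h :* p₂) :* x :+ (f :* p₃ :+ h :* p₁) :* y :+ (f :* p₂ :+ g :* p₁) :* z) :+ ((p₂ :* z :+ p₃ :* y) :* f :+ (g :* z :+ h :* y) :* p₁))
          refl f g h p₁ p₂ p₃ x y z) (trans (cong (_+ ((p₂ * z + p₃ * y) * f + (g * z + h * y) * p₁)) on) (+-identityˡ _)))
        (solve 7 (λ g h p₂ p₃ x y z → (g :* p₃ :+ h :* p₂) :* y := (p₂ :* z :+ p₃ :* y) :* g :+ (g :* z :+ h :* y) :* p₂) refl g h p₂ p₃ x y z)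
        (solve 7 (λ g h p₂ p₃ x y z → (g :* p₃ :+ h :* p₂) :* z := (p₂ :* z :+ p₃ :* y) :* h :+ (g :* z :+ h :* y) :* p₃) refl g h p₂ p₃ x y z))
      ... | _ | no ℓ₂≢0 | _ = multiple _ (p₁ * z + p₃ * x) (f * z + h * x) w w≢𝟎 Qw ℓ₂≢0 (triple
        (solve 7 (λ f h p₁ p₃ x y z → (f :* p₃ :+ h :* p₁) :* x := (p₁ :* z :+ p₃ :* x) :* f :+ (f :* z :+ h :* x) :* p₁) refl f h p₁ p₃ x y z)
        (trans (solve 9 (λ f g h p₁ p₂ p₃ x y z → (f :* p₃ :+ h :* p₁) :* y :=
            ((g :* p₃ :+ h :* p₂) :* x :+ (f :* p₃ :+ h :* p₁) :* y :+ (f :* p₂ :+ g :* p₁) :* z) :+ ((p₁ :* z :+ p₃ :* x) :* g :+ (f :* z :+ h :* x) :* p₂))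
          refl f g h p₁ p₂ p₃ x y z) (trans (cong (_+ ((p₁ * z + p₃ * x) * g + (f * z + h * x) * p₂)) on) (+-identityˡ _)))
        (solve 7 (λ f h p₁ p₃ x y z → (f :* p₃ :+ h :* p₁) :* z := (p₁ :* z :+ p₃ :* x) :* h :+ (f :* z :+ h :* x) :* p₃) refl f h p₁ p₃ x y z))
      ... | _ | _ | no ℓ₃≢0 = multiple _ (p₁ * y + p₂ * x) (f * y + g * x) w w≢𝟎 Qw ℓ₃≢0 (triple
        (solve 7 (λ f g p₁ p₂ x y z → (f :* p₂ :+ g :* p₁) :* x := (p₁ :* y :+ p₂ :* x) :* f :+ (f :* y :+ g :* x) :* p₁) refl f g p₁ p₂ x y z)
        (solve 7 (λ f g p₁ p₂ x y z → (f :* p₂ :+ g :* p₁) :* y := (p₁ :* y :+ p₂ :* x) :* g :+ (f :* y :+ g :* x) :* p₂) refl f g p₁ p₂ x y z)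
        (trans (solve 9 (λ f g h p₁ p₂ p₃ x y z → (f :* p₂ :+ g :* p₁) :* z :=
            ((g :* p₃ :+ h :* p₂) :* x :+ (f :* p₃ :+ h :* p₁) :* y :+ (f :* p₂ :+ g :* p₁) :* z) :+ ((p₁ :* y :+ p₂ :* x) :* h :+ (f :* y :+ g :* x) :* p₃))
          refl f g h p₁ p₂ p₃ x y z) (trans (cong (_+ ((p₁ * y + p₂ * x) * h + (f * y + g * x) * p₃)) on) (+-identityˡ _))))
      ... | yes ℓ₁≡0 | yes ℓ₂≡0 | yes ℓ₃≡0 = ⊥-elim (tangent≢𝟎 v v≢𝟎 Qv (triple ℓ₁≡0 ℓ₂≡0 ℓ₃≡0))

    -- The line joining w to ν meets the conic in w + s ν with s² Q(ν) = Q(w).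
    nucleus-collinear : ∀ N → IsNucleus Q N → ∀ w →
      let x , y , z = proj₁ N ; k , l , m = tangent w in k * x + l * y + m * z ≡ 0#
    nucleus-collinear N@((x , y , z) , _) nucleus w@(w₁ , w₂ , w₃) with det w ≟ 0#
      where
      det : Vec₃ → Carrier
      det w = let k , l , m = tangent w in k * x + l * y + m * z
    ... | yes eq = eq
    -- Adding a multiple of `ν` to `w` does not change the determinant, which being nonzero ensures
    -- that the vector found on the conic is not `𝟎`.
    ... | no det≢0 = trans (sym det-v) (nucleus (tangent v , tangent≢𝟎 v v≢𝟎 Qv) (tangent-isTangent (v , v≢𝟎) Qv))
      where
      open ≡-Reasoning
      det : Vec₃ → Carrier
      det w = let k , l , m = tangent w in k * x + l * y + m * z
      s = √ (eval Q w * eval Q ν ⁻¹)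
      v = (s · ν) ⊕ (1# · w)
      det-v : det v ≡ det w
      det-v = solve 10 (λ f g h x y z w₁ w₂ w₃ s →
        let D = λ w₁ w₂ w₃ → (g :* w₃ :+ h :* w₂) :* x :+ (f :* w₃ :+ h :* w₁) :* y :+ (f :* w₂ :+ g :* w₁) :* z in
        D (s :* f :+ con true :* w₁) (s :* g :+ con true :* w₂) (s :* h :+ con true :* w₃) := D w₁ w₂ w₃)
        refl f g h x y z w₁ w₂ w₃ s
      v≢𝟎 : v ≢ 𝟎
      v≢𝟎 v≡𝟎 = det≢0 (trans (sym det-v) (trans (cong det v≡𝟎)
        (solve 6 (λ f g h x y z → let o = con false in
          (g :* o :+ h :* o) :* x :+ (f :* o :+ h :* o) :* y :+ (f :* o :+ g :* o) :* z := o) refl f g h x y z)))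
      Qv : eval Q v ≡ 0#
      Qv = begin
        eval Q v                                             ≡⟨ combination s 1# w ⟩
        s * s * eval Q ν + 1# * 1# * eval Q w                ≡⟨ cong (λ t → t * eval Q ν + 1# * 1# * eval Q w) (√*√ _) ⟩
        eval Q w * eval Q ν ⁻¹ * eval Q ν + 1# * 1# * eval Q w
          ≡⟨ solve 3 (λ e i n → e :* i :* n :+ con true :* con true :* e := e :* (i :* n :+ con true)) refl (eval Q w) (eval Q ν ⁻¹) (eval Q ν) ⟩
        eval Q w * (eval Q ν ⁻¹ * eval Q ν + 1#)             ≡⟨ cong (eval Q w *_) (≡⇒+≡0 (⁻¹-inverseˡ evalν≢0)) ⟩
        eval Q w * 0#                                        ≡⟨ zeroʳ _ ⟩
        0#                                                   ∎

  private
    -- Once the linear coefficients are `h * X` and `h * Y`, translating to the centre `(X , Y)`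
    -- absorbs them, and `c` cancels between the two values.
    complete-square : ∀ a b c h i x y X Y →
      i * a * ((x + X) * (x + X)) + i * h * ((x + X) * (y + Y)) + i * b * ((y + Y) * (y + Y)) ≡
      i * eval (quadraticForm a b c (h * X) (h * Y) h) (x , y , 1#) + i * eval (quadraticForm a b c (h * X) (h * Y) h) (X , Y , 1#)
    complete-square = solve 9 (λ a b c h i x y X Y → let o = con true in
      i :* a :* ((x :+ X) :* (x :+ X)) :+ i :* h :* ((x :+ X) :* (y :+ Y)) :+ i :* b :* ((y :+ Y) :* (y :+ Y)) :=
      i :* (a :* (x :* x) :+ b :* (y :* y) :+ c :* (o :* o) :+ h :* X :* (y :* o) :+ h :* Y :* (x :* o) :+ h :* (x :* y)) :+
      i :* (a :* (X :* X) :+ b :* (Y :* Y) :+ c :* (o :* o) :+ h :* X :* (Y :* o) :+ h :* Y :* (X :* o) :+ h :* (X :* Y))) refl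

  module AffineConic (a b c f g h X₀ Y₀ i : Carrier)
    (hX₀≡f : h * X₀ ≡ f) (hY₀≡g : h * Y₀ ≡ g)
    (i-inverse : i * eval (quadraticForm a b c f g h) (X₀ , Y₀ , 1#) ≡ 1#) where
    open Hyperoval F k n≡ (i * a) (i * h) (i * b) X₀ Y₀ using (S; IsAnisotropic; On)
    Q = quadraticForm a b c f g h

    i≢0 : i ≢ 0#
    i≢0 i≡0 = 0≢1 (trans (sym (zeroˡ _)) (trans (cong (_* eval Q (X₀ , Y₀ , 1#)) (sym i≡0)) i-inverse))

    S-infinite : ∀ X Y → i * eval Q (X , Y , 0#) ≡ S X Y
    S-infinite = solve 9 (λ a b c f g h i X Y → let o = con false in
        i :* (a :* (X :* X) :+ b :* (Y :* Y) :+ c :* (o :* o) :+ f :* (Y :* o) :+ g :* (X :* o) :+ h :* (X :* Y))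
          := i :* a :* (X :* X) :+ i :* h :* (X :* Y) :+ i :* b :* (Y :* Y)) refl a b c f g h i

    -- The factor `i` inverts the value of the form at the centre, so that the conic becomes `S = 1`
    -- while the centre, the nucleus, has `S = 0`.
    S-centred : ∀ x y → S (x + X₀) (y + Y₀) ≡ i * eval Q (x , y , 1#) + 1#
    S-centred x y = begin
      S (x + X₀) (y + Y₀)                                       ≡⟨ complete-square a b c h i x y X₀ Y₀ ⟩
      i * ev (h * X₀) (h * Y₀) x y + i * ev (h * X₀) (h * Y₀) X₀ Y₀
        ≡⟨ cong₂ (λ f g → i * ev f g x y + i * ev f g X₀ Y₀) hX₀≡f hY₀≡g ⟩
      i * eval Q (x , y , 1#) + i * eval Q (X₀ , Y₀ , 1#)       ≡⟨ cong (i * eval Q (x , y , 1#) +_) i-inverse ⟩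
      i * eval Q (x , y , 1#) + 1#                              ∎
      where
      open ≡-Reasoning
      ev : Carrier → Carrier → Carrier → Carrier → Carrier
      ev f g x y = eval (quadraticForm a b c f g h) (x , y , 1#)

    S≡1⇒conic : ∀ x y → S (x + X₀) (y + Y₀) ≡ 1# → eval Q (x , y , 1#) ≡ 0#
    S≡1⇒conic x y S≡1 = x*y≡0⇒y≡0 i≢0 (begin
      i * eval Q (x , y , 1#)                ≡⟨ solve 1 (λ e → e := e :+ con true :+ con true) refl (i * eval Q (x , y , 1#)) ⟩
      i * eval Q (x , y , 1#) + 1# + 1#      ≡⟨ cong (_+ 1#) (trans (sym (S-centred x y)) S≡1) ⟩
      1# + 1#                                ≡⟨ 1+1≡0 ⟩
      0#                                     ∎)
      where open ≡-Reasoning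

    conic⇒S≡1 : ∀ x y → eval Q (x , y , 1#) ≡ 0# → S (x + X₀) (y + Y₀) ≡ 1#
    conic⇒S≡1 x y conic = trans (S-centred x y) (trans (cong (λ e → i * e + 1#) conic)
      (solve 1 (λ i → i :* con false :+ con true := con true) refl i))

    S-nucleus : ∀ x y → x ≡ X₀ → y ≡ Y₀ → S (x + X₀) (y + Y₀) ≡ 0#
    S-nucleus x y x≡ y≡ = trans (cong₂ S (≡⇒+≡0 x≡) (≡⇒+≡0 y≡))
      (solve 3 (λ a h b → let o = con false in a :* (o :* o) :+ h :* (o :* o) :+ b :* (o :* o) := o) refl (i * a) (i * h) (i * b))

    affine : Carrier × Carrier → PGPoint
    affine (x , y) = (x , y , 1#) , λ eq → 0≢1 (sym (cong (proj₂ ∘ proj₂) eq))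

    module _ (Ω : Pred (Carrier × Carrier) 0ℓ) (N₃ : Carrier) (N₃≢0 : N₃ ≢ 0#)
      (N≢𝟎 : (N₃ * X₀ , N₃ * Y₀ , N₃) ≢ 𝟎)
      (H⇔ : ∀ P → FromAffine Ω P ⇔ (Conic Q P ⊎ P ∼ ((N₃ * X₀ , N₃ * Y₀ , N₃) , N≢𝟎))) where

      not-infinite : ∀ v → FromAffine Ω v → proj₂ (proj₂ (proj₁ v)) ≢ 0#
      not-infinite _ (_ , _ , _ , t , t≢0 , eq) z≡0 =
        t≢0 (trans (sym (*-identityʳ t)) (trans (sym (cong (proj₂ ∘ proj₂) eq)) z≡0))

      at-infinity : ∀ X Y → S X Y ≡ 0# → ¬ (X , Y , 0#) ≢ 𝟎
      at-infinity X Y S≡0 ≢𝟎 = not-infinite ((X , Y , 0#) , ≢𝟎)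
        (Equivalence.from (H⇔ ((X , Y , 0#) , ≢𝟎)) (inj₁ (x*y≡0⇒y≡0 i≢0 (trans (S-infinite X Y) S≡0)))) refl

      -- A nontrivial zero of `S` would be a point of the conic on the line at infinity, but all
      -- points of the hyperoval are affine.
      anisotropic : IsAnisotropic
      anisotropic X Y S≡0 with X ≟ 0# | Y ≟ 0#
      ... | yes X≡0 | yes Y≡0 = X≡0 , Y≡0
      ... | no X≢0  | _       = ⊥-elim (at-infinity X Y S≡0 (X≢0 ∘ cong proj₁))
      ... | yes _   | no Y≢0  = ⊥-elim (at-infinity X Y S≡0 (Y≢0 ∘ cong (proj₁ ∘ proj₂)))

      Ω⇒On : ∀ P → Ω P → On P
      Ω⇒On P@(x , y) ΩP = Sum.swap (Sum.map (conic⇒S≡1 x y) nucleus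
        (Equivalence.to (H⇔ (affine P)) (x , y , ΩP , 1# , (0≢1 ∘ sym) , 1·v≡v _)))
        where
        nucleus : affine P ∼ ((N₃ * X₀ , N₃ * Y₀ , N₃) , N≢𝟎) → S (x + X₀) (y + Y₀) ≡ 0#
        nucleus (t , _ , eq) = S-nucleus x y (at (cong proj₁ eq)) (at (cong (proj₁ ∘ proj₂) eq))
          where
          at : ∀ {X x} → x ≡ t * (N₃ * X) → x ≡ X
          at {X} e = trans e (trans (sym (*-assoc t N₃ X)) (trans (cong (_* X) (sym (cong (proj₂ ∘ proj₂) eq))) (*-identityˡ X)))

      On⇒Ω : ∀ P → On P → Ω P
      On⇒Ω P@(x , y) on = unscale (Equivalence.from (H⇔ (affine P)) (projective on))
        where
        projective : On P → Conic Q (affine P) ⊎ affine P ∼ ((N₃ * X₀ , N₃ * Y₀ , N₃) , N≢𝟎)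
        projective (inj₂ S≡1) = inj₁ (S≡1⇒conic x y S≡1)
        projective (inj₁ S≡0) = let X≡0 , Y≡0 = anisotropic _ _ S≡0 in
          inj₂ (N₃ ⁻¹ , ⁻¹-≢0 N₃≢0 , triple (at (+≡0⇒≡ X≡0)) (at (+≡0⇒≡ Y≡0)) (sym (⁻¹-inverseˡ N₃≢0)))
          where
          at : ∀ {x X} → x ≡ X → x ≡ N₃ ⁻¹ * (N₃ * X)
          at {x} {X} x≡X = trans x≡X (sym (trans (sym (*-assoc _ N₃ X)) (trans (cong (_* X) (⁻¹-inverseˡ N₃≢0)) (*-identityˡ X))))
        unscale : FromAffine Ω (affine P) → Ω P
        unscale (x′ , y′ , ΩP , t , t≢0 , eq) = subst Ω (sym (cong₂ _,_ (at (cong proj₁ eq)) (at (cong (proj₁ ∘ proj₂) eq)))) ΩP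
          where
          at : ∀ {x x′} → x ≡ t * x′ → x ≡ x′
          at {x} {x′} e = trans e (trans (cong (_* x′) (trans (sym (*-identityʳ t)) (sym (cong (proj₂ ∘ proj₂) eq)))) (*-identityˡ x′))

  NormalForm : Pred (Carrier × Carrier) 0ℓ → Set
  NormalForm Ω = ∃[ a ] ∃[ h ] ∃[ b ] ∃[ X₀ ] ∃[ Y₀ ]
    Hyperoval.IsAnisotropic F k n≡ a h b X₀ Y₀ × (∀ P → Ω P ⇔ Hyperoval.On F k n≡ a h b X₀ Y₀ P)

  -- Collinearity of the nucleus with `ν` and each of two unit vectors makes it proportional to
  -- `ν = (f , g , h)`. Since it is affine, `h` is nonzero, and the centre is `(f / h , g / h)`.
  normal-form : ∀ (Ω : Pred (Carrier × Carrier) 0ℓ) → IsAffineRegularHyperoval Ω → NormalForm Ω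
  normal-form Ω (quadraticForm a b c f g h , N@((N₁ , N₂ , N₃) , N≢𝟎) , nondegenerate , nucleus , H⇔) =
    finish (h ⁻¹ * f) (h ⁻¹ * g) (h*h⁻¹* f) (h*h⁻¹* g) (coordinate f*N₃≡h*N₁) (coordinate g*N₃≡h*N₂)
    where
    open ≡-Reasoning
    open ConicNucleus a b c f g h nondegenerate

    N₃≢0 : N₃ ≢ 0#
    N₃≢0 N₃≡0 = let _ , _ , _ , t , t≢0 , N≡ = Equivalence.from (H⇔ N) (inj₂ (1# , (0≢1 ∘ sym) , 1·v≡v (proj₁ N))) in
      t≢0 (trans (sym (*-identityʳ t)) (trans (sym (cong (proj₂ ∘ proj₂) N≡)) N₃≡0))

    g*N₃≡h*N₂ : g * N₃ ≡ h * N₂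
    g*N₃≡h*N₂ = +≡0⇒≡ (trans (solve 6 (λ f g h x y z → let o = con false ; i = con true in
      g :* z :+ h :* y := (g :* o :+ h :* o) :* x :+ (f :* o :+ h :* i) :* y :+ (f :* o :+ g :* i) :* z) refl f g h N₁ N₂ N₃)
      (nucleus-collinear N nucleus (1# , 0# , 0#)))

    f*N₃≡h*N₁ : f * N₃ ≡ h * N₁
    f*N₃≡h*N₁ = +≡0⇒≡ (trans (solve 6 (λ f g h x y z → let o = con false ; i = con true in
      f :* z :+ h :* x := (g :* o :+ h :* i) :* x :+ (f :* o :+ h :* o) :* y :+ (f :* i :+ g :* o) :* z) refl f g h N₁ N₂ N₃)
      (nucleus-collinear N nucleus (0# , 1# , 0#)))

    h≢0 : h ≢ 0#
    h≢0 h≡0 = ν≢𝟎 (triple (vanish f*N₃≡h*N₁) (vanish g*N₃≡h*N₂) h≡0)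
      where
      vanish : ∀ {r s} → r * N₃ ≡ h * s → r ≡ 0#
      vanish {r} {s} eq = x*y≡0⇒y≡0 N₃≢0 (trans (*-comm N₃ r) (trans eq (trans (cong (_* s) h≡0) (zeroˡ s))))

    h*h⁻¹* : ∀ r → h * (h ⁻¹ * r) ≡ r
    h*h⁻¹* r = trans (sym (*-assoc h _ r)) (trans (cong (_* r) (⁻¹-inverseʳ h≢0)) (*-identityˡ r))

    coordinate : ∀ {r s} → r * N₃ ≡ h * s → s ≡ N₃ * (h ⁻¹ * r)
    coordinate {r} {s} eq = *-cancelˡ h≢0 (begin
      h * s                      ≡⟨ eq ⟨
      r * N₃                     ≡⟨ cong (_* N₃) (h*h⁻¹* r) ⟨
      h * (h ⁻¹ * r) * N₃        ≡⟨ solve 3 (λ h X n → h :* X :* n := h :* (n :* X)) refl h (h ⁻¹ * r) N₃ ⟩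
      h * (N₃ * (h ⁻¹ * r))      ∎)

    finish : ∀ X₀ Y₀ → h * X₀ ≡ f → h * Y₀ ≡ g → N₁ ≡ N₃ * X₀ → N₂ ≡ N₃ * Y₀ → NormalForm Ω
    finish X₀ Y₀ hX₀≡f hY₀≡g refl refl = i * a , i * h , i * b , X₀ , Y₀ , anisotropic Ω N₃ N₃≢0 N≢𝟎 H⇔ ,
      λ P → mk⇔ (Ω⇒On Ω N₃ N₃≢0 N≢𝟎 H⇔ P) (On⇒Ω Ω N₃ N₃≢0 N≢𝟎 H⇔ P)
      where
      C≢0 : eval Q (X₀ , Y₀ , 1#) ≢ 0#
      C≢0 C≡0 = evalν≢0 (begin
        eval Q ν                              ≡⟨ cong (eval Q) (triple hX₀≡f hY₀≡g (*-identityʳ h)) ⟨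
        eval Q (h · (X₀ , Y₀ , 1#))           ≡⟨ scale h (X₀ , Y₀ , 1#) ⟩
        h * h * eval Q (X₀ , Y₀ , 1#)         ≡⟨ cong (h * h *_) C≡0 ⟩
        h * h * 0#                            ≡⟨ zeroʳ _ ⟩
        0#                                    ∎)
      i = eval Q (X₀ , Y₀ , 1#) ⁻¹
      open AffineConic a b c f g h X₀ Y₀ i hX₀≡f hY₀≡g (⁻¹-inverseˡ C≢0) using (anisotropic; Ω⇒On; On⇒Ω)

-- The dual André plane: the arc property, and added points at infinity or in Φ.

IsAdditivePower IsInvolutivePower : ∀ {n} → FiniteField n → ℕ → Set
IsAdditivePower F q = ∀ x y → (x + y) ^ q ≡ x ^ q + y ^ q
  where open FiniteField F
IsInvolutivePower F q = ∀ x → (x ^ q) ^ q ≡ x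
  where open FiniteField F

module Arcs {n : ℕ} (F : FiniteField n) (k : ℕ) (n≡ : n ≡ 2 ℕ.^ suc k)
  (q : ℕ) (2≤q : 2 ≤ q)
  (frobenius : IsAdditivePower F q) (involutive : IsInvolutivePower F q)
  {U : Pred (FiniteField.Carrier F) 0ℓ} (U? : Decidable U) (U⊆ : U ⊆ GF⋆ F q)
  (a h b X₀ Y₀ : FiniteField.Carrier F)
  (anisotropic : Hyperoval.IsAnisotropic F k n≡ a h b X₀ Y₀) where

  open FiniteField F
  open Characteristic2 F k n≡
  open Hyperoval F k n≡ a h b X₀ Y₀
  open DualAndréPlane F q U?

  norm : ∀ x → ∥ x ∥ ≡ x * x ^ q
  norm x = cong (x ^_) (ℕ.+-comm q 1)

  ⊙-outside : ∀ m x → ¬ U ∥ x ∥ → m ⊙ x ≡ m * x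
  ⊙-outside m x x∉ with U? ∥ x ∥
  ... | yes x∈ = contradiction x∈ x∉
  ... | no _   = refl

  ⊙-inside : ∀ m x → U ∥ x ∥ → m ⊙ x ≡ m ^ q * x
  ⊙-inside m x x∈ with U? ∥ x ∥
  ... | yes _ = refl
  ... | no x∉ = contradiction x∈ x∉

  parallel-slope : ∀ m n x y x′ y′ → y ≡ m * x + n → y′ ≡ m * x′ + n → Parallel (1# , m) (x , y) (x′ , y′)
  parallel-slope m n x y x′ y′ refl refl =
    solve 4 (λ m n x x′ → con true :* (m :* x′ :+ n :+ (m :* x :+ n)) :+ m :* (x′ :+ x) := con false) refl m n x x′

  slope-parallel : ∀ m n x y x′ y′ → y ≡ m * x + n → Parallel (1# , m) (x , y) (x′ , y′) → y′ ≡ m * x′ + n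
  slope-parallel m n x y x′ y′ refl par = +≡0⇒≡ (trans
    (solve 5 (λ m n x x′ y′ → y′ :+ (m :* x′ :+ n) := con true :* (y′ :+ (m :* x :+ n)) :+ m :* (x′ :+ x)) refl m n x x′ y′) par)

  slope-nonZero : ∀ m → NonZero (1# , m)
  slope-nonZero m (eq , _) = 0≢1 (sym eq)

  vertical-nonZero : NonZero (0# , 1#)
  vertical-nonZero (_ , eq) = 0≢1 (sym eq)

  parallel-vertical : ∀ x y x′ y′ → x ≡ x′ → Parallel (0# , 1#) (x , y) (x′ , y′)
  parallel-vertical x y x′ y′ refl =
    solve 3 (λ x y y′ → con false :* (y′ :+ y) :+ con true :* (x :+ x) := con false) refl x y y′

  vertical-parallel : ∀ x y x′ y′ → Parallel (0# , 1#) (x , y) (x′ , y′) → x ≡ x′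
  vertical-parallel x y x′ y′ par = sym (+≡0⇒≡ (trans
    (solve 4 (λ x y x′ y′ → x′ :+ x := con false :* (y′ :+ y) :+ con true :* (x′ :+ x)) refl x y x′ y′) par))

  -- Only the parametrised points of the conic are counted: their parameters run through the whole
  -- field, so there are `n` of them.
  conic-coding⇒≤ : ∀ {C : Set} (codes : List C) (R : Carrier × Carrier → C → Set) →
                   (∀ V → (∃[ τ ] V ≡ conicPoint anisotropic τ) → On V → ∃[ c ] c ∈ codes × R V c) →
                   (∀ V W c → On V → On W → R V c → R W c → V ≡ W) → n ≤ length codes
  conic-coding⇒≤ codes R encode decode = coding⇒≤ codes (λ τ → R (conicPoint anisotropic τ))
    (λ τ → encode (conicPoint anisotropic τ) (τ , refl) (conicPoint-on anisotropic τ))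
    (λ σ τ c Rσ Rτ → conicPoint-injective anisotropic
      (decode _ _ c (conicPoint-on anisotropic σ) (conicPoint-on anisotropic τ) Rσ Rτ))

  ordinates-≤2 : ∀ x → length (filter (λ y → On? (x , y)) elements) ≤ 2
  ordinates-≤2 x = length-≤2 _ (filter-elements-unique on?)
    (λ y₁ y₂ y₃ on₁ on₂ on₃ y₁≢y₂ y₁≢y₃ y₂≢y₃ → y₂≢y₃ (cong proj₂ (at-most-two anisotropic vertical-nonZero
      (∈-filter-elements⁻ on? on₁) (∈-filter-elements⁻ on? on₂) (∈-filter-elements⁻ on? on₃)
      (y₁≢y₂ ∘ sym ∘ cong proj₂) (y₁≢y₃ ∘ sym ∘ cong proj₂)
      (parallel-vertical x y₁ x y₂ refl) (parallel-vertical x y₁ x y₃ refl))))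
    where
    on? : ∀ y → Dec (On (x , y))
    on? y = On? (x , y)

  normFibre : Carrier → List Carrier
  normFibre u = filter (λ x → x ^ suc q + u ≟ 0#) elements

  normFibre-≤ : ∀ u → length (normFibre u) ≤ suc q
  normFibre-≤ u = roots-≤ (suc q) (degree-+ (suc q) (degree-^ (suc q)) (degree-constant q u))
    (λ eq → 0≢1 (sym (trans (sym (+-identityʳ 1#)) eq)))

  fibre : Carrier → List (Carrier × Carrier)
  fibre x = map (x ,_) (filter (λ y → On? (x , y)) elements)

  -- The points of Ω in Ψ, listed by norm `u` in `U`, then by abscissa (a root of `x ^ suc q + u`,
  -- hence at most `q + 1` of them), then by ordinate (at most two on a vertical line).
  inside : List (Carrier × Carrier)
  inside = concatMap (λ u → concatMap fibre (normFibre u)) (filter U? elements)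

  length-inside : length inside ≤ 2 ℕ.* suc q ℕ.* card U?
  length-inside = length-concatMap-≤ (λ u → concatMap fibre (normFibre u)) (2 ℕ.* suc q) (filter U? elements)
    (λ u _ → ℕ.≤-trans
      (length-concatMap-≤ fibre 2 (normFibre u) (λ x _ → subst (_≤ 2) (sym (length-map (x ,_) (filter (λ y → On? (x , y)) elements))) (ordinates-≤2 x)))
      (ℕ.*-monoʳ-≤ 2 (normFibre-≤ u)))

  ∈-inside : ∀ x y → On (x , y) → U ∥ x ∥ → (x , y) ∈ inside
  ∈-inside x y onP x∈ = ∈-concatMap⁺ (λ u → concatMap fibre (normFibre u)) (lose (∈-filter-elements U? x∈)
    (∈-concatMap⁺ fibre (lose (∈-filter-elements (λ x′ → x′ ^ suc q + ∥ x ∥ ≟ 0#) (≡⇒+≡0 (sym (norm x))))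
      (∈-map⁺ (x ,_) (∈-filter-elements (λ y → On? (x , y)) onP)))))

  module _ (Ω : Pred (Carrier × Carrier) 0ℓ) (Ω⇒On : ∀ P → Ω P → On P) (On⇒Ω : ∀ P → On P → Ω P) where

    ⋆-isArc : IsArc (Ω ⋆)
    ⋆-isArc (P x y) (P x′ y′) (P x″ y″) (ΩA , x∉) (ΩB , x′∉) (ΩC , x″∉) A≢B A≢C B≢C [ c ] (x≡c , x′≡c , x″≡c) =
      B≢C (cong (λ (x , y) → P x y) (at-most-two anisotropic vertical-nonZero (Ω⇒On _ ΩA) (Ω⇒On _ ΩB) (Ω⇒On _ ΩC)
        (A≢B ∘ cong (λ (x , y) → P x y) ∘ sym) (A≢C ∘ cong (λ (x , y) → P x y) ∘ sym)
        (parallel-vertical x y x′ y′ (trans x≡c (sym x′≡c))) (parallel-vertical x y x″ y″ (trans x≡c (sym x″≡c)))))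
    ⋆-isArc (P x y) (P x′ y′) (P x″ y″) (ΩA , x∉) (ΩB , x′∉) (ΩC , x″∉) A≢B A≢C B≢C [ m ∣ l ] (A-on , B-on , C-on) =
      B≢C (cong (λ (x , y) → P x y) (at-most-two anisotropic (slope-nonZero m) (Ω⇒On _ ΩA) (Ω⇒On _ ΩB) (Ω⇒On _ ΩC)
        (A≢B ∘ cong (λ (x , y) → P x y) ∘ sym) (A≢C ∘ cong (λ (x , y) → P x y) ∘ sym)
        (parallel-slope m l x y x′ y′ (plain x∉ A-on) (plain x′∉ B-on))
        (parallel-slope m l x y x″ y″ (plain x∉ A-on) (plain x″∉ C-on))))
      where
      plain : ∀ {x y} → ¬ U ∥ x ∥ → y ≡ m ⊙ x + l → y ≡ m * x + l
      plain {x} x∉ eq = trans eq (cong (_+ l) (⊙-outside m x x∉))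
    ⋆-isArc (P _ _) _ _ _ _ _ _ _ _ ℓ∞ (() , _)

    module Extension (A : Point) (arc : IsArc ((Ω ⋆) ∪ ｛ A ｝)) (A∉ : ¬ (Ω ⋆) A) where

      blocked : ∀ x y x′ y′ → On (x , y) → On (x′ , y′) → (x′ , y′) ≢ (x , y) → ¬ U ∥ x ∥ → ¬ U ∥ x′ ∥ →
                ∀ ℓ → P x y on ℓ → P x′ y′ on ℓ → ¬ (A on ℓ)
      blocked x y x′ y′ onP onP′ P′≢P x∉ x′∉ ℓ P-on P′-on A-on =
        arc (P x y) (P x′ y′) A (inj₁ PΩ) (inj₁ P′Ω) (inj₂ refl)
          (λ { refl → P′≢P refl }) (λ { refl → A∉ PΩ }) (λ { refl → A∉ P′Ω }) ℓ (P-on , P′-on , A-on)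
        where
        PΩ : (Ω ⋆) (P x y)
        PΩ = On⇒Ω _ onP , x∉
        P′Ω : (Ω ⋆) (P x′ y′)
        P′Ω = On⇒Ω _ onP′ , x′∉

      -- D P is the direction in AG(2,F) of the line joining P to A.
      module Pencil (D : Carrier × Carrier → Carrier × Carrier)
        (D-nonZero : ∀ P → On P → NonZero (D P))
        (D-symmetric : ∀ P R → Parallel (D P) P R → Parallel (D R) R P)
        (D-line : ∀ x y x′ y′ → On (x , y) → On (x′ , y′) → (x′ , y′) ≢ (x , y) → ¬ U ∥ x ∥ → ¬ U ∥ x′ ∥ →
                  Parallel (D (x , y)) (x , y) (x′ , y′) → ⊥) where

        -- A point of Ψ is its own code. A point of Φ is coded by the other point of Ω on its line
        -- to `A`, which is in Ψ by `D-line`; by `D-symmetric` that point has the same line to `A`,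
        -- from which the coded point is recovered.
        codes : List ((Carrier × Carrier) ⊎ (Carrier × Carrier))
        codes = map inj₁ inside ++ map inj₂ inside

        length-codes : length codes ≤ 2 ℕ.* (2 ℕ.* suc q ℕ.* card U?)
        length-codes = begin
          length codes                                               ≡⟨ length-++ (map inj₁ inside) ⟩
          length (map inj₁ inside) ℕ.+ length (map inj₂ inside)      ≡⟨ cong₂ ℕ._+_ (length-map inj₁ inside) (length-map inj₂ inside) ⟩
          length inside ℕ.+ length inside                            ≡⟨ cong (length inside ℕ.+_) (ℕ.+-identityʳ (length inside)) ⟨
          2 ℕ.* length inside                                        ≤⟨ ℕ.*-monoʳ-≤ 2 length-inside ⟩
          2 ℕ.* (2 ℕ.* suc q ℕ.* card U?)                            ∎
          where open ℕ.≤-Reasoning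

        Code : Carrier × Carrier → (Carrier × Carrier) ⊎ (Carrier × Carrier) → Set
        Code V (inj₁ R) = V ≡ R
        Code V (inj₂ R) = On R × V ≢ R × Parallel (D R) R V

        encode : ∀ V → On V → ∃[ c ] c ∈ codes × Code V c
        encode V@(x , y) onV with U? ∥ x ∥
        ... | yes x∈ = inj₁ V , ∈-++⁺ˡ (∈-map⁺ inj₁ (∈-inside x y onV x∈)) , refl
        ... | no x∉ with second anisotropic (D-nonZero V onV) onV
        ...   | R@(x′ , y′) , onR , R≢V , par , _ with U? ∥ x′ ∥
        ...     | yes R∈ = inj₂ R , ∈-++⁺ʳ (map inj₁ inside) (∈-map⁺ inj₂ (∈-inside x′ y′ onR R∈)) ,
                           onR , R≢V ∘ sym , D-symmetric V R par
        ...     | no R∉ = ⊥-elim (D-line x y x′ y′ onV onR R≢V x∉ R∉ par)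

        decode : ∀ V W c → On V → On W → Code V c → Code W c → V ≡ W
        decode V W (inj₁ R) _ _ V≡ W≡ = trans V≡ (sym W≡)
        decode V W (inj₂ R) onV onW (onR , V≢ , V-par) (_ , W≢ , W-par) =
          at-most-two anisotropic (D-nonZero R onR) onR onV onW V≢ W≢ V-par W-par

        n-≤ : n ≤ 2 ℕ.* (2 ℕ.* suc q ℕ.* card U?)
        n-≤ = ℕ.≤-trans (conic-coding⇒≤ codes Code (λ V _ → encode V) decode) length-codes

    -- On abscissas with norm outside `U` the product `⊙` is that of the field, so an affine line
    -- through the added point and two points of Φ is also a line of the dual André plane at these
    -- three points.
    outside-point-≤ : ∀ x₁ y₁ → ¬ U ∥ x₁ ∥ → ¬ On (x₁ , y₁) → IsArc ((Ω ⋆) ∪ ｛ P x₁ y₁ ｝) →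
                      n ≤ 2 ℕ.* (2 ℕ.* suc q ℕ.* card U?)
    outside-point-≤ x₁ y₁ x₁∉ A-off arc = Pencil.n-≤ D D-nonZero D-symmetric D-line
      where
      open Extension (P x₁ y₁) arc (λ A∈ → A-off (Ω⇒On _ (proj₁ A∈)))
      D : Carrier × Carrier → Carrier × Carrier
      D (x , y) = x₁ + x , y₁ + y
      D-nonZero : ∀ P → On P → NonZero (D P)
      D-nonZero (x , y) onP (eq , eq′) = A-off (subst On (sym (cong₂ _,_ (+≡0⇒≡ eq) (+≡0⇒≡ eq′))) onP)
      D-symmetric : ∀ P R → Parallel (D P) P R → Parallel (D R) R P
      D-symmetric (x , y) (x′ , y′) par = trans (solve 6 (λ x₁ y₁ x y x′ y′ →
        (x₁ :+ x′) :* (y :+ y′) :+ (y₁ :+ y′) :* (x :+ x′) := (x₁ :+ x) :* (y′ :+ y) :+ (y₁ :+ y) :* (x′ :+ x)) refl x₁ y₁ x y x′ y′) par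
      D-line : ∀ x y x′ y′ → On (x , y) → On (x′ , y′) → (x′ , y′) ≢ (x , y) → ¬ U ∥ x ∥ → ¬ U ∥ x′ ∥ →
               Parallel (D (x , y)) (x , y) (x′ , y′) → ⊥
      D-line x y x′ y′ onP onP′ P′≢P x∉ x′∉ par with x′ + x ≟ 0#
      ... | yes Δx≡0 = blocked x y x′ y′ onP onP′ P′≢P x∉ x′∉ [ x ] refl x′≡x (+≡0⇒≡ (x*y≡0⇒y≡0 Δy≢0 (begin
          (y′ + y) * (x₁ + x)                            ≡⟨ solve 3 (λ v w e → v :* w := w :* v :+ e :* con false) refl (y′ + y) (x₁ + x) (y₁ + y) ⟩
          (x₁ + x) * (y′ + y) + (y₁ + y) * 0#            ≡⟨ cong (λ z → (x₁ + x) * (y′ + y) + (y₁ + y) * z) Δx≡0 ⟨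
          (x₁ + x) * (y′ + y) + (y₁ + y) * (x′ + x)      ≡⟨ par ⟩
          0#                                             ∎)))
        where
        open ≡-Reasoning
        x′≡x = +≡0⇒≡ Δx≡0
        Δy≢0 : y′ + y ≢ 0#
        Δy≢0 Δy≡0 = P′≢P (cong₂ _,_ x′≡x (+≡0⇒≡ Δy≡0))
      ... | no Δx≢0 = blocked x y x′ y′ onP onP′ P′≢P x∉ x′∉ [ m ∣ y + m * x ]
          (join x y x∉ (solve 3 (λ m x y → m :* (x :+ x) := y :+ y) refl m x y))
          (join x′ y′ x′∉ m*Δx≡Δy)
          (join x₁ y₁ x₁∉ (*-cancelˡ Δx≢0 (begin
            (x′ + x) * (m * (x₁ + x))       ≡⟨ solve 3 (λ w m d → w :* (m :* d) := d :* (m :* w)) refl (x′ + x) m (x₁ + x) ⟩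
            (x₁ + x) * (m * (x′ + x))       ≡⟨ cong ((x₁ + x) *_) m*Δx≡Δy ⟩
            (x₁ + x) * (y′ + y)             ≡⟨ +≡0⇒≡ par ⟩
            (y₁ + y) * (x′ + x)             ≡⟨ *-comm _ _ ⟩
            (x′ + x) * (y₁ + y)             ∎)))
        where
        open ≡-Reasoning
        m = (y′ + y) * (x′ + x) ⁻¹
        m*Δx≡Δy : m * (x′ + x) ≡ y′ + y
        m*Δx≡Δy = x*y⁻¹*y≡x (y′ + y) Δx≢0
        join : ∀ z w → ¬ U ∥ z ∥ → m * (z + x) ≡ w + y → w ≡ m ⊙ z + (y + m * x)
        join z w z∉ eq = begin
          w                        ≡⟨ solve 2 (λ w y → w := w :+ y :+ y) refl w y ⟩
          w + y + y                ≡⟨ cong (_+ y) eq ⟨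
          m * (z + x) + y          ≡⟨ solve 4 (λ m z x y → m :* (z :+ x) :+ y := m :* z :+ (y :+ m :* x)) refl m z x y ⟩
          m * z + (y + m * x)      ≡⟨ cong (_+ (y + m * x)) (⊙-outside m z z∉) ⟨
          m ⊙ z + (y + m * x)      ∎

    slope-≤ : ∀ m → IsArc ((Ω ⋆) ∪ ｛ slope m ｝) → n ≤ 2 ℕ.* (2 ℕ.* suc q ℕ.* card U?)
    slope-≤ m arc = Pencil.n-≤ (λ _ → 1# , m) (λ _ _ → slope-nonZero m) D-symmetric D-line
      where
      open Extension (slope m) arc (λ ())
      D-symmetric : ∀ P R → Parallel (1# , m) P R → Parallel (1# , m) R P
      D-symmetric (x , y) (x′ , y′) par = trans (cong₂ (λ v w → 1# * v + m * w) (+-comm y y′) (+-comm x x′)) par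
      D-line : ∀ x y x′ y′ → On (x , y) → On (x′ , y′) → (x′ , y′) ≢ (x , y) → ¬ U ∥ x ∥ → ¬ U ∥ x′ ∥ →
               Parallel (1# , m) (x , y) (x′ , y′) → ⊥
      D-line x y x′ y′ onP onP′ P′≢P x∉ x′∉ par = blocked x y x′ y′ onP onP′ P′≢P x∉ x′∉ [ m ∣ y + m * x ]
        (trans y≡ (cong (_+ _) (sym (⊙-outside m x x∉))))
        (trans (slope-parallel m _ x y x′ y′ y≡ par) (cong (_+ _) (sym (⊙-outside m x′ x′∉)))) refl
        where
        y≡ : y ≡ m * x + (y + m * x)
        y≡ = solve 2 (λ y z → y := z :+ (y :+ z)) refl y (m * x)

    vertical-≤ : IsArc ((Ω ⋆) ∪ ｛ vertical ｝) → n ≤ 2 ℕ.* (2 ℕ.* suc q ℕ.* card U?)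
    vertical-≤ arc = Pencil.n-≤ (λ _ → 0# , 1#) (λ _ _ → vertical-nonZero)
      (λ { (x , y) (x′ , y′) par → parallel-vertical x′ y′ x y (sym (vertical-parallel x y x′ y′ par)) })
      (λ x y x′ y′ onP onP′ P′≢P x∉ x′∉ par → blocked x y x′ y′ onP onP′ P′≢P x∉ x′∉ [ x ] refl
        (sym (vertical-parallel x y x′ y′ par)) _)
      where open Extension vertical arc (λ ())

  ^q-* : ∀ x y → (x * y) ^ q ≡ x ^ q * y ^ q
  ^q-* x y = ^-distrib-* x y q

  norm^q : ∀ x → (x * x ^ q) ^ q ≡ x * x ^ q
  norm^q x = trans (^q-* x (x ^ q)) (trans (cong (x ^ q *_) (involutive x)) (*-comm _ _))

  -- An added point in Ψ: the lines through it and the Baer involution.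

  module InsidePoint (x₀ y₀ : Carrier) (x₀∈U : U ∥ x₀ ∥) where

    u : Carrier
    u = x₀ * x₀ ^ q

    Y₁ : Carrier
    Y₁ = y₀ + Y₀

    u≢0 : u ≢ 0#
    u≢0 u≡0 = proj₂ (U⊆ x₀∈U) (trans (norm x₀) u≡0)

    x₀≢0 : x₀ ≢ 0#
    x₀≢0 x₀≡0 = u≢0 (trans (cong (_* x₀ ^ q) x₀≡0) (zeroˡ _))

    norm≢u : ∀ {x} → ¬ U ∥ x ∥ → x * x ^ q ≢ u
    norm≢u {x} x∉ eq = x∉ (subst U (trans (norm x₀) (trans (sym eq) (sym (norm x)))) x₀∈U)

    -- The points P x y with ∥ x ∥ ∉ U on the line of slope m through P x₀ y₀ in the dual André plane.
    OnLine : Carrier → Carrier × Carrier → Set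
    OnLine m (x , y) = y ≡ m * x + (m ^ q * x₀ + y₀)

    line-difference : ∀ {m x y} → OnLine m (x , y) → y + y₀ ≡ m * x + m ^ q * x₀
    line-difference {m} {x} refl = solve 3 (λ s t y₀ → s :+ (t :+ y₀) :+ y₀ := s :+ t) refl (m * x) (m ^ q * x₀) y₀

    line-conjugate : ∀ {m x y} → OnLine m (x , y) → (y + y₀) ^ q ≡ m ^ q * x ^ q + m * x₀ ^ q
    line-conjugate {m} {x} {y} line = begin
      (y + y₀) ^ q                            ≡⟨ cong (_^ q) (line-difference line) ⟩
      (m * x + m ^ q * x₀) ^ q                ≡⟨ frobenius _ _ ⟩
      (m * x) ^ q + (m ^ q * x₀) ^ q          ≡⟨ cong₂ _+_ (^q-* m x) (^q-* (m ^ q) x₀) ⟩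
      m ^ q * x ^ q + (m ^ q) ^ q * x₀ ^ q    ≡⟨ cong (λ z → m ^ q * x ^ q + z * x₀ ^ q) (involutive m) ⟩
      m ^ q * x ^ q + m * x₀ ^ q              ∎
      where open ≡-Reasoning

    -- Elimination of `m ^ q` between the equation of the line and its `q`-th power.
    line-determinant : ∀ {m x y} → OnLine m (x , y) → (y + y₀) * x ^ q + (y + y₀) ^ q * x₀ ≡ m * (x * x ^ q + u)
    line-determinant {m} {x} {y} line = begin
      (y + y₀) * x ^ q + (y + y₀) ^ q * x₀                                     ≡⟨ cong₂ (λ d e → d * x ^ q + e * x₀) (line-difference line) (line-conjugate line) ⟩
      (m * x + m ^ q * x₀) * x ^ q + (m ^ q * x ^ q + m * x₀ ^ q) * x₀         ≡⟨ solve 6 (λ m M x X x₀ X₀ →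
        (m :* x :+ M :* x₀) :* X :+ (M :* X :+ m :* X₀) :* x₀ := m :* (x :* X :+ x₀ :* X₀)) refl m (m ^ q) x (x ^ q) x₀ (x₀ ^ q) ⟩
      m * (x * x ^ q + u)                                                      ∎
      where open ≡-Reasoning

    slopeTo : Carrier × Carrier → Carrier
    slopeTo (x , y) = ((y + y₀) * x ^ q + (y + y₀) ^ q * x₀) * (x * x ^ q + u) ⁻¹

    slopeTo-unique : ∀ {m x y} → x * x ^ q ≢ u → OnLine m (x , y) → m ≡ slopeTo (x , y)
    slopeTo-unique {m} {x} {y} x≢u line = begin
      m                                             ≡⟨ *-identityʳ m ⟨
      m * 1#                                        ≡⟨ cong (m *_) (⁻¹-inverseʳ (x≢u ∘ +≡0⇒≡)) ⟨
      m * ((x * x ^ q + u) * (x * x ^ q + u) ⁻¹)    ≡⟨ *-assoc _ _ _ ⟨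
      m * (x * x ^ q + u) * (x * x ^ q + u) ⁻¹      ≡⟨ cong (_* (x * x ^ q + u) ⁻¹) (line-determinant line) ⟨
      slopeTo (x , y)                               ∎
      where open ≡-Reasoning

    -- Cramer's rule treats `m` and `m ^ q` as independent unknowns. Its two solutions are
    -- compatible because the determinant lies in GF(q), so it and its inverse are fixed by the
    -- `q`-th power.
    slopeTo-line : ∀ x y → x * x ^ q ≢ u → OnLine (slopeTo (x , y)) (x , y)
    slopeTo-line x y x≢u = +≡0⇒≡ (begin
        y + (m * x + (m ^ q * x₀ + y₀))                   ≡⟨ cong (λ M → y + (m * x + (M * x₀ + y₀))) m^q ⟩
        y + (m * x + ((d ^ q * x + d * x₀ ^ q) * i * x₀ + y₀))
          ≡⟨ solve 8 (λ y y₀ e x X x₀ X₀ i → let d = y :+ y₀ in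
               y :+ ((d :* X :+ e :* x₀) :* i :* x :+ ((e :* x :+ d :* X₀) :* i :* x₀ :+ y₀))
                 := d :* (con true :+ (x :* X :+ x₀ :* X₀) :* i)) refl y y₀ (d ^ q) x (x ^ q) x₀ (x₀ ^ q) i ⟩
        d * (1# + Δ * i)                                  ≡⟨ cong (d *_) (≡⇒+≡0 (sym Δ*i)) ⟩
        d * 0#                                            ≡⟨ zeroʳ d ⟩
        0#                                                ∎)
      where
      open ≡-Reasoning
      d = y + y₀
      Δ = x * x ^ q + u
      i = Δ ⁻¹
      m = slopeTo (x , y)
      Δ≢0 : Δ ≢ 0#
      Δ≢0 = x≢u ∘ +≡0⇒≡
      Δ*i : Δ * i ≡ 1#
      Δ*i = ⁻¹-inverseʳ Δ≢0
      Δ^q : Δ ^ q ≡ Δ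
      Δ^q = trans (frobenius _ _) (cong₂ _+_ (norm^q x) (norm^q x₀))
      i^q : i ^ q ≡ i
      i^q = *-cancelˡ Δ≢0 (begin
        Δ * i ^ q         ≡⟨ cong (_* i ^ q) Δ^q ⟨
        Δ ^ q * i ^ q     ≡⟨ ^q-* Δ i ⟨
        (Δ * i) ^ q       ≡⟨ cong (_^ q) Δ*i ⟩
        1# ^ q            ≡⟨ 1^ q ⟩
        1#                ≡⟨ Δ*i ⟨
        Δ * i             ∎)
      m^q : m ^ q ≡ (d ^ q * x + d * x₀ ^ q) * i
      m^q = begin
        m ^ q                                                       ≡⟨ ^q-* _ i ⟩
        (d * x ^ q + d ^ q * x₀) ^ q * i ^ q                        ≡⟨ cong₂ _*_ (frobenius _ _) i^q ⟩
        ((d * x ^ q) ^ q + (d ^ q * x₀) ^ q) * i                    ≡⟨ cong₂ (λ s t → (s + t) * i) (^q-* d (x ^ q)) (^q-* (d ^ q) x₀) ⟩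
        (d ^ q * (x ^ q) ^ q + (d ^ q) ^ q * x₀ ^ q) * i            ≡⟨ cong₂ (λ s t → (d ^ q * s + t * x₀ ^ q) * i) (involutive x) (involutive d) ⟩
        (d ^ q * x + d * x₀ ^ q) * i                                ∎

    slopes : Carrier × Carrier → List Carrier
    slopes (x , y) = filter (λ m → x₀ * m ^ q + (x * m + (y + y₀)) ≟ 0#) elements

    slopes-≤ : ∀ V → length (slopes V) ≤ q
    slopes-≤ (x , y) = roots-≤ q (degree-+ q (degree-* q x₀ (degree-^ q)) (degree-linear q 2≤q x (y + y₀)))
      (λ eq → x₀≢0 (trans (solve 1 (λ x → x := x :* con true :+ con false) refl x₀) eq))

    ∈-slopes : ∀ {m x y} → OnLine m (x , y) → m ∈ slopes (x , y)
    ∈-slopes {m} {x} {y} line = ∈-filter-elements (λ m → x₀ * m ^ q + (x * m + (y + y₀)) ≟ 0#) (begin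
      x₀ * m ^ q + (x * m + (y + y₀))                 ≡⟨ cong (λ d → x₀ * m ^ q + (x * m + d)) (line-difference line) ⟩
      x₀ * m ^ q + (x * m + (m * x + m ^ q * x₀))     ≡⟨ solve 4 (λ x₀ M x m → x₀ :* M :+ (x :* m :+ (m :* x :+ M :* x₀)) := con false) refl x₀ (m ^ q) x m ⟩
      0#                                              ∎)
      where open ≡-Reasoning

    -- The Baer involution fixing the lines y = m x + (m ^ q x₀ + y₀) is (x , y) ↦ (u / x ^ q , x₀ (y + y₀) ^ q / x ^ q + y₀);
    -- T vanishes at the points which it maps to the conic.
    T : Carrier × Carrier → Carrier
    T (x , y) = S (u + X₀ * x ^ q) (x₀ * (y + y₀) ^ q + Y₁ * x ^ q) + x ^ q * x ^ q

    -- With `w = τ ^ q`, `p̂ w` is `p τ ^ q`, while `x̂ w` and `d̂ w` are the `q`-th powers of `x`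
    -- and `y + y₀` at the conic point, multiplied by `p τ ^ q` to clear denominators. Thus `T̂ w`
    -- is `T` times a nonzero square; its ingredients are quadratic in `w` and enter quadratically,
    -- hence degree 4.
    p̂ x̂ d̂ T̂ : Carrier → Carrier
    p̂ w = √ a ^ q + √ h ^ q * w + √ b ^ q * (w * w)
    x̂ w = 1# + X₀ ^ q * p̂ w
    d̂ w = w * w + Y₁ ^ q * p̂ w
    T̂ w = S (u * p̂ w + X₀ * x̂ w) (x₀ * d̂ w + Y₁ * x̂ w) + x̂ w * x̂ w

    T̂-degree : HasDegree 4 T̂
    T̂-degree = hasDegree-+
      (hasDegree-+ (hasDegree-+ (hasDegree-* a (hasDegree-product A A)) (hasDegree-* h (hasDegree-product A B)))
        (hasDegree-* b (hasDegree-product B B)))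
      (hasDegree-product x-degree x-degree)
      where
      constant : ∀ c → HasDegree 2 (λ _ → c)
      constant c = 0# , degree-constant 1 c
      square : HasDegree 2 (λ w → w * w)
      square = hasDegree-product {1} {1} identity identity
        where
        identity : HasDegree 1 (λ w → w)
        identity = 1# , 0# , (λ _ → 1#) , (λ _ → refl) , λ w → solve 1 (λ w → w := con false :+ w :* con true) refl w
      p-degree : HasDegree 2 p̂
      p-degree = _ , degree-cong 2 refl (λ w → solve 4 (λ a h b w → h :* w :+ a :+ b :* (w :* w) := a :+ h :* w :+ b :* (w :* w)) refl (√ a ^ q) (√ h ^ q) (√ b ^ q) w)
        (degree-+ 2 (degree-linear 2 (s≤s (s≤s z≤n)) (√ h ^ q) (√ a ^ q)) (proj₂ (hasDegree-* (√ b ^ q) square)))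
      x-degree : HasDegree 2 x̂
      x-degree = hasDegree-+ (constant 1#) (hasDegree-* (X₀ ^ q) p-degree)
      d-degree : HasDegree 2 d̂
      d-degree = hasDegree-+ square (hasDegree-* (Y₁ ^ q) p-degree)
      A : HasDegree 2 (λ w → u * p̂ w + X₀ * x̂ w)
      A = hasDegree-+ (hasDegree-* u p-degree) (hasDegree-* X₀ x-degree)
      B : HasDegree 2 (λ w → x₀ * d̂ w + Y₁ * x̂ w)
      B = hasDegree-+ (hasDegree-* x₀ d-degree) (hasDegree-* Y₁ x-degree)

    T̂-value : ∀ τ → T̂ (τ ^ q) ≡ p anisotropic τ ^ q * p anisotropic τ ^ q * T (conicPoint anisotropic τ)
    T̂-value τ = begin
      T̂ w
        ≡⟨ cong₂ (λ X e → S (u * p̂ w + X₀ * X) (x₀ * e + Y₁ * X) + X * X) x̂≡ d̂≡ ⟨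
      S (u * p̂ w + X₀ * (P̂ * X)) (x₀ * (P̂ * e) + Y₁ * (P̂ * X)) + P̂ * X * (P̂ * X)
        ≡⟨ cong (λ z → S (u * z + X₀ * (P̂ * X)) (x₀ * (P̂ * e) + Y₁ * (P̂ * X)) + P̂ * X * (P̂ * X)) p̂≡ ⟨
      S (u * P̂ + X₀ * (P̂ * X)) (x₀ * (P̂ * e) + Y₁ * (P̂ * X)) + P̂ * X * (P̂ * X)
        ≡⟨ cong₂ (λ s t → S s t + P̂ * X * (P̂ * X))
             (solve 4 (λ u P x X → u :* P :+ x :* (P :* X) := P :* (u :+ x :* X)) refl u P̂ X₀ X)
             (solve 5 (λ x P e y X → x :* (P :* e) :+ y :* (P :* X) := P :* (x :* e :+ y :* X)) refl x₀ P̂ e Y₁ X) ⟩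
      S (P̂ * (u + X₀ * X)) (P̂ * (x₀ * e + Y₁ * X)) + P̂ * X * (P̂ * X)
        ≡⟨ cong (_+ P̂ * X * (P̂ * X)) (S-scale anisotropic P̂ _ _) ⟩
      P̂ * P̂ * S (u + X₀ * X) (x₀ * e + Y₁ * X) + P̂ * X * (P̂ * X)
        ≡⟨ solve 3 (λ P s X → P :* P :* s :+ P :* X :* (P :* X) := P :* P :* (s :+ X :* X)) refl P̂ (S (u + X₀ * X) (x₀ * e + Y₁ * X)) X ⟩
      P̂ * P̂ * (S (u + X₀ * X) (x₀ * e + Y₁ * X) + X * X) ∎
      where
      open ≡-Reasoning
      w = τ ^ q
      π = p anisotropic τ
      i = π ⁻¹
      P̂ = π ^ q
      X = (i + X₀) ^ q
      e = (i * (τ * τ) + Y₀ + y₀) ^ q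
      π*i : π * i ≡ 1#
      π*i = ⁻¹-inverseʳ (p≢0 anisotropic τ)
      p̂≡ : P̂ ≡ p̂ w
      p̂≡ = begin
        (√ a + √ h * τ + √ b * (τ * τ)) ^ q                   ≡⟨ trans (frobenius _ _) (cong (_+ (√ b * (τ * τ)) ^ q) (frobenius _ _)) ⟩
        √ a ^ q + (√ h * τ) ^ q + (√ b * (τ * τ)) ^ q         ≡⟨ cong₂ (λ s t → √ a ^ q + s + t) (^q-* _ _) (trans (^q-* _ _) (cong (√ b ^ q *_) (^q-* τ τ))) ⟩
        p̂ w                                                   ∎
      x̂≡ : P̂ * X ≡ x̂ w
      x̂≡ = begin
        P̂ * X                          ≡⟨ ^q-* π (i + X₀) ⟨
        (π * (i + X₀)) ^ q             ≡⟨ cong (_^ q) (trans (solve 3 (λ p i x → p :* (i :+ x) := p :* i :+ x :* p) refl π i X₀) (cong (_+ X₀ * π) π*i)) ⟩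
        (1# + X₀ * π) ^ q              ≡⟨ trans (frobenius _ _) (cong₂ _+_ (1^ q) (^q-* X₀ π)) ⟩
        1# + X₀ ^ q * P̂                ≡⟨ cong (λ z → 1# + X₀ ^ q * z) p̂≡ ⟩
        x̂ w                            ∎
      d̂≡ : P̂ * e ≡ d̂ w
      d̂≡ = begin
        P̂ * e                                        ≡⟨ ^q-* π _ ⟨
        (π * (i * (τ * τ) + Y₀ + y₀)) ^ q            ≡⟨ cong (_^ q) (solve 5 (λ p i t y y′ → p :* (i :* t :+ y :+ y′) := p :* i :* t :+ (y′ :+ y) :* p) refl π i (τ * τ) Y₀ y₀) ⟩
        (π * i * (τ * τ) + Y₁ * π) ^ q               ≡⟨ cong (λ z → (z * (τ * τ) + Y₁ * π) ^ q) π*i ⟩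
        (1# * (τ * τ) + Y₁ * π) ^ q                  ≡⟨ cong (λ z → (z + Y₁ * π) ^ q) (*-identityˡ _) ⟩
        (τ * τ + Y₁ * π) ^ q                         ≡⟨ trans (frobenius _ _) (cong₂ _+_ (^q-* τ τ) (^q-* Y₁ π)) ⟩
        w * w + Y₁ ^ q * P̂                           ≡⟨ cong (λ z → w * w + Y₁ ^ q * z) p̂≡ ⟩
        d̂ w                                          ∎

    -- At norm `u` the determinant vanishes, so `line-determinant` gives
    -- `x₀ (y + y₀)^q = (y + y₀) x^q`: the point is its own Baer image, and `T` reduces to
    -- `x^q x^q (S + 1)`.
    fixed⇒T≡0 : ∀ {m x y} → S (x + X₀) (y + Y₀) ≡ 1# → x * x ^ q ≡ u → OnLine m (x , y) → T (x , y) ≡ 0#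
    fixed⇒T≡0 {m} {x} {y} S≡1 x≡u line = begin
      S (u + X₀ * X) (x₀ * e + Y₁ * X) + X * X             ≡⟨ cong₂ (λ s t → S s t + X * X) first second-coordinate ⟩
      S (X * (x + X₀)) (X * (y + Y₀)) + X * X              ≡⟨ cong (_+ X * X) (S-scale anisotropic X _ _) ⟩
      X * X * S (x + X₀) (y + Y₀) + X * X                  ≡⟨ cong (λ s → X * X * s + X * X) S≡1 ⟩
      X * X * 1# + X * X                                   ≡⟨ solve 1 (λ X → X :* X :* con true :+ X :* X := con false) refl X ⟩
      0#                                                   ∎
      where
      open ≡-Reasoning
      X = x ^ q
      e = (y + y₀) ^ q
      first : u + X₀ * X ≡ X * (x + X₀)
      first = trans (cong (_+ X₀ * X) (sym x≡u)) (solve 3 (λ x X x₀ → x :* X :+ x₀ :* X := X :* (x :+ x₀)) refl x X X₀)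
      e*x₀ : (y + y₀) * X + e * x₀ ≡ 0#
      e*x₀ = trans (line-determinant line) (trans (cong (m *_) (≡⇒+≡0 x≡u)) (zeroʳ m))
      second-coordinate : x₀ * e + Y₁ * X ≡ X * (y + Y₀)
      second-coordinate = begin
        x₀ * e + Y₁ * X              ≡⟨ cong (_+ Y₁ * X) (trans (*-comm x₀ e) (sym (+≡0⇒≡ e*x₀))) ⟩
        (y + y₀) * X + Y₁ * X        ≡⟨ solve 4 (λ y y₀ Y₀ X → (y :+ y₀) :* X :+ (y₀ :+ Y₀) :* X := X :* (y :+ Y₀)) refl y y₀ Y₀ X ⟩
        X * (y + Y₀)                 ∎

    -- The involution would fix both points of Ω on the line, as it fixes R.
    no-fixed : ∀ {m x y x′ y′} → T (x , y) ≡ 0# → x * x ^ q ≢ u → OnLine m (x , y) → On (x , y) →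
               On (x′ , y′) → (x′ , y′) ≢ (x , y) → OnLine m (x′ , y′) → x′ * x′ ^ q ≢ u
    no-fixed {m} {x} {y} {x′} {y′} T≡0 x≢u line onV onR R≢V line′ x′≡u =
      x≢u (trans (cong (_* X) (cong proj₁ V≡image)) (x*y⁻¹*y≡x u X≢0))
      where
      open ≡-Reasoning
      X = x ^ q
      e = (y + y₀) ^ q
      -- For `X = 0#`, the vanishing of `T` would be a zero of `S` with first argument `u`, against
      -- anisotropy.
      X≢0 : X ≢ 0#
      X≢0 X≡0 = u≢0 (trans (solve 2 (λ u x → u := u :+ x :* con false) refl u X₀)
        (trans (cong (λ z → u + X₀ * z) (sym X≡0)) (proj₁ (anisotropic _ _ (begin
          S (u + X₀ * X) (x₀ * e + Y₁ * X)            ≡⟨ +-identityʳ _ ⟨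
          S (u + X₀ * X) (x₀ * e + Y₁ * X) + 0#       ≡⟨ cong (S (u + X₀ * X) (x₀ * e + Y₁ * X) +_) (trans (cong (X *_) X≡0) (zeroʳ X)) ⟨
          T (x , y)                                   ≡⟨ T≡0 ⟩
          0#                                          ∎)))))
      j = X ⁻¹
      X*j : X * j ≡ 1#
      X*j = ⁻¹-inverseʳ X≢0
      image : Carrier × Carrier
      image = u * j , x₀ * e * j + y₀
      image-on : On image
      image-on = inj₂ (begin
        S (u * j + X₀) (x₀ * e * j + y₀ + Y₀)
          ≡⟨ cong₂ S (factor u X₀) (trans (+-assoc _ _ _) (factor (x₀ * e) Y₁)) ⟩
        S (j * (u + X₀ * X)) (j * (x₀ * e + Y₁ * X))            ≡⟨ S-scale anisotropic j _ _ ⟩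
        j * j * S (u + X₀ * X) (x₀ * e + Y₁ * X)                ≡⟨ cong (j * j *_) (+≡0⇒≡ T≡0) ⟩
        j * j * (X * X)                                         ≡⟨ solve 2 (λ j X → j :* j :* (X :* X) := (X :* j) :* (X :* j)) refl j X ⟩
        (X * j) * (X * j)                                       ≡⟨ cong₂ _*_ X*j X*j ⟩
        1# * 1#                                                 ≡⟨ *-identityˡ 1# ⟩
        1#                                                      ∎)
        where
        factor : ∀ s t → s * j + t ≡ j * (s + t * X)
        factor s t = begin
          s * j + t                ≡⟨ cong (s * j +_) (*-identityʳ t) ⟨
          s * j + t * 1#           ≡⟨ cong (λ z → s * j + t * z) X*j ⟨
          s * j + t * (X * j)      ≡⟨ solve 4 (λ s j t X → s :* j :+ t :* (X :* j) := j :* (s :+ t :* X)) refl s j t X ⟩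
          j * (s + t * X)          ∎
      image-line : OnLine m image
      image-line = begin
        x₀ * e * j + y₀                                               ≡⟨ cong (λ z → x₀ * z * j + y₀) (line-conjugate line) ⟩
        x₀ * (m ^ q * X + m * x₀ ^ q) * j + y₀                        ≡⟨ solve 7 (λ x₀ M X m Z j y₀ →
          x₀ :* (M :* X :+ m :* Z) :* j :+ y₀ := m :* (x₀ :* Z :* j) :+ (M :* x₀ :* (X :* j) :+ y₀)) refl x₀ (m ^ q) X m (x₀ ^ q) j y₀ ⟩
        m * (u * j) + (m ^ q * x₀ * (X * j) + y₀)                     ≡⟨ cong (λ z → m * (u * j) + (m ^ q * x₀ * z + y₀)) X*j ⟩
        m * (u * j) + (m ^ q * x₀ * 1# + y₀)                          ≡⟨ cong (λ z → m * (u * j) + (z + y₀)) (*-identityʳ _) ⟩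
        m * (u * j) + (m ^ q * x₀ + y₀)                               ∎
      -- The image has norm `u * u / ∥ x ∥`, which is the norm `u` of the second point only if
      -- `∥ x ∥` is `u`.
      image≢R : image ≢ (x′ , y′)
      image≢R eq = x≢u (*-cancelˡ u≢0 (begin
        u * (x * X)                                  ≡⟨ cong (_* (x * X)) x′≡u ⟨
        x′ * x′ ^ q * (x * X)                        ≡⟨ cong (λ z → z * z ^ q * (x * X)) (cong proj₁ eq) ⟨
        u * j * (u * j) ^ q * (x * X)                ≡⟨ cong (λ z → u * j * z * (x * X)) (trans (^q-* u j) (cong (_* j ^ q) (norm^q x₀))) ⟩
        u * j * (u * j ^ q) * (x * X)                ≡⟨ solve 5 (λ u j J x X → u :* j :* (u :* J) :* (x :* X) := u :* u :* ((X :* j) :* (x :* J))) refl u j (j ^ q) x X ⟩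
        u * u * ((X * j) * (x * j ^ q))              ≡⟨ cong₂ (λ s t → u * u * (s * t)) X*j x*j^q ⟩
        u * u * (1# * 1#)                            ≡⟨ solve 1 (λ u → u :* u :* (con true :* con true) := u :* u) refl u ⟩
        u * u                                        ∎))
        where
        x*j^q : x * j ^ q ≡ 1#
        x*j^q = begin
          x * j ^ q              ≡⟨ cong (_* j ^ q) (involutive x) ⟨
          X ^ q * j ^ q          ≡⟨ ^q-* X j ⟨
          (X * j) ^ q            ≡⟨ cong (_^ q) X*j ⟩
          1# ^ q                 ≡⟨ 1^ q ⟩
          1#                     ∎
      -- The second point, `(x , y)` and the image all lie on Ω and on one affine line, so the last
      -- two coincide; then `x = u / x^q`.
      V≡image : (x , y) ≡ image
      V≡image = at-most-two anisotropic (slope-nonZero m) onR onV image-on (R≢V ∘ sym) image≢R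
        (parallel-slope m _ x′ y′ x y line′ line) (parallel-slope m _ x′ y′ _ _ line′ image-line)

    -- An added point in Ψ: fixed points on the hyperoval and the count.

    -- Second points of norm `u` are the ones that need several codes. The first point is required
    -- to have a parameter because `many-fixed⇒T≡0` controls `T` only at parametrised points.
    Candidates : List (Carrier × Carrier) → Set
    Candidates L = ∀ {m x y x′ y′} → (∃[ τ ] (x , y) ≡ conicPoint anisotropic τ) → On (x , y) → x * x ^ q ≢ u → OnLine m (x , y) →
      On (x′ , y′) → (x′ , y′) ≢ (x , y) → OnLine m (x′ , y′) → x′ * x′ ^ q ≡ u → (x′ , y′) ∈ L

    fixedParameters : List Carrier
    fixedParameters = filter (λ τ → T (conicPoint anisotropic τ) ≟ 0#) elements

    many-fixed⇒T≡0 : 4 < length fixedParameters → ∀ τ → T (conicPoint anisotropic τ) ≡ 0#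
    many-fixed⇒T≡0 4< τ = x*y≡0⇒y≡0 (*-≢0 (^-≢0 q (p≢0 anisotropic τ)) (^-≢0 q (p≢0 anisotropic τ)))
      (trans (sym (T̂-value τ)) (proj₂ (many-roots 4 (proj₂ T̂-degree) (map (_^ q) fixedParameters)
        (Unique.map⁺ ^q-injective (filter-elements-unique T?))
        (All.map⁺ (All.tabulate (λ {σ} σ∈ → trans (T̂-value σ) (trans (cong (p anisotropic σ ^ q * p anisotropic σ ^ q *_)
          (∈-filter-elements⁻ T? σ∈)) (zeroʳ _)))))
        (subst (4 <_) (sym (length-map (_^ q) fixedParameters)) 4<)) (τ ^ q)))
      where
      T? : ∀ τ → Dec (T (conicPoint anisotropic τ) ≡ 0#)
      T? τ = T (conicPoint anisotropic τ) ≟ 0#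
      ^q-injective : ∀ {x y} → x ^ q ≡ y ^ q → x ≡ y
      ^q-injective {x} {y} eq = trans (sym (involutive x)) (trans (cong (_^ q) eq) (involutive y))

    candidates : ∃[ L ] length L ≤ 6 × Candidates L
    candidates with length fixedParameters ℕ.≤? 4
    ... | no ≰4 = [] , z≤n , λ { (τ , refl) onV V≢u line onR R≢V line′ R≡u →
            ⊥-elim (no-fixed (many-fixed⇒T≡0 (ℕ.≰⇒> ≰4) τ) V≢u line onV onR R≢V line′ R≡u) }
    ... | yes ≤4 = L , s≤s (s≤s (subst (_≤ 4) (sym (length-map (conicPoint anisotropic) fixedParameters)) ≤4)) ,
            λ _ _ _ _ onR _ line′ R≡u → member onR line′ R≡u
      where
      L : List (Carrier × Carrier)
      -- The nucleus and the conic point without a parameter are listed unconditionally, so the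
      -- bound is 4 + 2.
      L = (X₀ , Y₀) ∷ (X₀ , √ (b ⁻¹) + Y₀) ∷ map (conicPoint anisotropic) fixedParameters
      member : ∀ {m x y} → On (x , y) → OnLine m (x , y) → x * x ^ q ≡ u → (x , y) ∈ L
      member {m} {x} {y} onR line R≡u with on-classification anisotropic (x , y) onR
      ... | inj₁ refl = here refl
      ... | inj₂ (inj₁ refl) = there (here refl)
      ... | inj₂ (inj₂ (τ , refl)) = there (there (∈-map⁺ (conicPoint anisotropic)
        (∈-filter-elements (λ τ → T (conicPoint anisotropic τ) ≟ 0#) (fixed⇒T≡0 (conicPoint-S anisotropic τ) R≡u line))))

    inside-point-≤ : (Ω : Pred (Carrier × Carrier) 0ℓ) (Ω⇒On : ∀ V → Ω V → On V) (On⇒Ω : ∀ V → On V → Ω V) →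
      IsArc ((Ω ⋆) ∪ ｛ P x₀ y₀ ｝) → n ≤ 2 ℕ.* (2 ℕ.* suc q ℕ.* card U?) ℕ.+ q ℕ.* 6
    inside-point-≤ Ω Ω⇒On On⇒Ω arc = ℕ.≤-trans (conic-coding⇒≤ codes Code encode decode) length-codes
      where
      open Extension Ω Ω⇒On On⇒Ω (P x₀ y₀) arc (λ A∈ → proj₂ A∈ x₀∈U) using (blocked)

      L = proj₁ candidates

      -- A code is a second point in Ψ together with the slope of the line. If the norm of the
      -- second point is not `u`, the slope is determined and one code suffices; each of the at most
      -- six candidates takes up to `q` slopes.
      generic special : List ((Carrier × Carrier) × Carrier)
      generic = map (λ V → V , slopeTo V) inside
      special = concatMap (λ V → map (V ,_) (slopes V)) L

      codes : List ((Carrier × Carrier) ⊎ ((Carrier × Carrier) × Carrier))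
      codes = map inj₁ inside ++ map inj₂ (generic ++ special)

      length-codes : length codes ≤ 2 ℕ.* (2 ℕ.* suc q ℕ.* card U?) ℕ.+ q ℕ.* 6
      length-codes = begin
        length codes
          ≡⟨ length-++ (map inj₁ inside) ⟩
        length (map {B = (Carrier × Carrier) ⊎ ((Carrier × Carrier) × Carrier)} inj₁ inside) ℕ.+ length (map {B = (Carrier × Carrier) ⊎ ((Carrier × Carrier) × Carrier)} inj₂ (generic ++ special))
          ≡⟨ cong₂ ℕ._+_ (length-map inj₁ inside) (trans (length-map inj₂ (generic ++ special)) (length-++ generic)) ⟩
        length inside ℕ.+ (length generic ℕ.+ length special)
          ≡⟨ cong (λ l → length inside ℕ.+ (l ℕ.+ length special)) (length-map (λ V → V , slopeTo V) inside) ⟩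
        length inside ℕ.+ (length inside ℕ.+ length special)
          ≤⟨ ℕ.+-mono-≤ length-inside (ℕ.+-mono-≤ length-inside (ℕ.≤-trans
               (length-concatMap-≤ (λ V → map (V ,_) (slopes V)) q L
                 (λ V _ → subst (_≤ q) (sym (length-map (V ,_) (slopes V))) (slopes-≤ V)))
               (ℕ.*-monoʳ-≤ q (proj₁ (proj₂ candidates))))) ⟩
        N ℕ.+ (N ℕ.+ q ℕ.* 6)
          ≡⟨ ℕ.+-assoc N N (q ℕ.* 6) ⟨
        N ℕ.+ N ℕ.+ q ℕ.* 6
          ≡⟨ cong (λ l → N ℕ.+ l ℕ.+ q ℕ.* 6) (ℕ.+-identityʳ N) ⟨
        2 ℕ.* N ℕ.+ q ℕ.* 6 ∎
        where
        open ℕ.≤-Reasoning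
        N = 2 ℕ.* suc q ℕ.* card U?

      Code : Carrier × Carrier → (Carrier × Carrier) ⊎ ((Carrier × Carrier) × Carrier) → Set
      Code V (inj₁ R)       = V ≡ R
      Code V (inj₂ (R , m)) = On R × V ≢ R × OnLine m R × OnLine m V

      decode : ∀ V W c → On V → On W → Code V c → Code W c → V ≡ W
      decode V W (inj₁ R) _ _ V≡ W≡ = trans V≡ (sym W≡)
      decode (x , y) (x′ , y′) (inj₂ ((x″ , y″) , m)) onV onW (onR , V≢ , R-line , V-line) (_ , W≢ , _ , W-line) =
        at-most-two anisotropic (slope-nonZero m) onR onV onW V≢ W≢
          (parallel-slope m _ x″ y″ x y R-line V-line) (parallel-slope m _ x″ y″ x′ y′ R-line W-line)

      encode-line : ∀ m x y → (∃[ τ ] (x , y) ≡ conicPoint anisotropic τ) → On (x , y) → ¬ U ∥ x ∥ → OnLine m (x , y) →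
                    ∃[ c ] c ∈ codes × Code (x , y) c
      encode-line m x y param onV x∉ line with second anisotropic (slope-nonZero m) onV
      ... | (x′ , y′) , onR , R≢V , par , _ = code (U? ∥ x′ ∥) (x′ * x′ ^ q ≟ u)
        where
        R = x′ , y′
        line′ : OnLine m R
        line′ = slope-parallel m _ x y x′ y′ line par
        ℓ-point : ∀ {x y} → ¬ U ∥ x ∥ → OnLine m (x , y) → P x y on [ m ∣ m ^ q * x₀ + y₀ ]
        ℓ-point {x} x∉ line = trans line (cong (_+ (m ^ q * x₀ + y₀)) (sym (⊙-outside m x x∉)))
        A-on : P x₀ y₀ on [ m ∣ m ^ q * x₀ + y₀ ]
        A-on = trans (solve 2 (λ s y → y := s :+ (s :+ y)) refl (m ^ q * x₀) y₀)
          (cong (_+ (m ^ q * x₀ + y₀)) (sym (⊙-inside m x₀ x₀∈U)))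
        code : Dec (U ∥ x′ ∥) → Dec (x′ * x′ ^ q ≡ u) → ∃[ c ] c ∈ codes × Code (x , y) c
        code (no R∉) _ = ⊥-elim (blocked x y x′ y′ onV onR R≢V x∉ R∉ [ m ∣ m ^ q * x₀ + y₀ ] (ℓ-point x∉ line) (ℓ-point R∉ line′) A-on)
        code (yes R∈) (no R≢u) = inj₂ (R , m) ,
          ∈-++⁺ʳ (map inj₁ inside) (∈-map⁺ inj₂ (∈-++⁺ˡ (subst (λ m → (R , m) ∈ generic) (sym (slopeTo-unique R≢u line′))
            (∈-map⁺ (λ V → V , slopeTo V) (∈-inside x′ y′ onR R∈))))) , onR , R≢V ∘ sym , line′ , line
        code (yes R∈) (yes R≡u) = inj₂ (R , m) ,
          ∈-++⁺ʳ (map inj₁ inside) (∈-map⁺ inj₂ (∈-++⁺ʳ generic (∈-concatMap⁺ (λ V → map (V ,_) (slopes V))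
            (lose (proj₂ (proj₂ candidates) param onV (norm≢u x∉) line onR R≢V line′ R≡u)
              (∈-map⁺ (R ,_) (∈-slopes line′)))))) , onR , R≢V ∘ sym , line′ , line

      encode : ∀ V → (∃[ τ ] V ≡ conicPoint anisotropic τ) → On V → ∃[ c ] c ∈ codes × Code V c
      encode (x , y) param onV = code (U? ∥ x ∥)
        where
        code : Dec (U ∥ x ∥) → ∃[ c ] c ∈ codes × Code (x , y) c
        code (yes x∈) = inj₁ (x , y) , ∈-++⁺ˡ (∈-map⁺ inj₁ (∈-inside x y onV x∈)) , refl
        code (no x∉)  = encode-line (slopeTo (x , y)) x y param onV x∉ (slopeTo-line x y (norm≢u x∉))

-- The numerical contradiction and the completeness theorem.

-- The hypothesis amounts to `4c + 8 ≤ q`. The left side is `4c + q (4c + 6)`; replacing `4c` by `q`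
-- and adding one more `q` for strictness gives `q (4c + 8)`.
counting-bound : ∀ q c → c < q ℕ./ 4 ℕ.∸ 1 → 2 ℕ.* (2 ℕ.* suc q ℕ.* c) ℕ.+ q ℕ.* 6 < q ℕ.^ 2
counting-bound q c c< = begin-strict
  2 ℕ.* (2 ℕ.* suc q ℕ.* c) ℕ.+ q ℕ.* 6      ≡⟨ expand q c ⟩
  4 ℕ.* c ℕ.+ (q ℕ.* (4 ℕ.* c) ℕ.+ q ℕ.* 6)  ≤⟨ ℕ.+-monoˡ-≤ _ (ℕ.≤-trans (ℕ.m≤m+n (4 ℕ.* c) 8) 4c+8≤q) ⟩
  q ℕ.+ (q ℕ.* (4 ℕ.* c) ℕ.+ q ℕ.* 6)        <⟨ ℕ.m<n+m _ 0<q ⟩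
  q ℕ.+ (q ℕ.+ (q ℕ.* (4 ℕ.* c) ℕ.+ q ℕ.* 6)) ≡⟨ collect q c ⟩
  q ℕ.* (4 ℕ.* c ℕ.+ 8)                      ≤⟨ ℕ.*-monoʳ-≤ q 4c+8≤q ⟩
  q ℕ.* q                                    ≡⟨ cong (q ℕ.*_) (ℕ.*-identityʳ q) ⟨
  q ℕ.^ 2                                    ∎
  where
  open ℕ.≤-Reasoning
  open ℕSolver.+-*-Solver
  expand : ∀ q c → 2 ℕ.* (2 ℕ.* suc q ℕ.* c) ℕ.+ q ℕ.* 6 ≡ 4 ℕ.* c ℕ.+ (q ℕ.* (4 ℕ.* c) ℕ.+ q ℕ.* 6)
  expand = solve 2 (λ q c → con 2 :* (con 2 :* (con 1 :+ q) :* c) :+ q :* con 6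
    := con 4 :* c :+ (q :* (con 4 :* c) :+ q :* con 6)) refl
  collect : ∀ q c → q ℕ.+ (q ℕ.+ (q ℕ.* (4 ℕ.* c) ℕ.+ q ℕ.* 6)) ≡ q ℕ.* (4 ℕ.* c ℕ.+ 8)
  collect = solve 2 (λ q c → q :+ (q :+ (q :* (con 4 :* c) :+ q :* con 6)) := q :* (con 4 :* c :+ con 8)) refl
  -- Subtraction is truncated, but a number below `n ∸ 1` exists only if `n` is a successor.
  m<n∸1⇒2+m≤n : ∀ {m} n → m < n ℕ.∸ 1 → 2 ℕ.+ m ≤ n
  m<n∸1⇒2+m≤n (suc n) m<n = s≤s m<n
  4c+8≤q : 4 ℕ.* c ℕ.+ 8 ≤ q
  4c+8≤q = begin
    4 ℕ.* c ℕ.+ 8         ≡⟨ solve 1 (λ c → con 4 :* c :+ con 8 := (con 2 :+ c) :* con 4) refl c ⟩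
    (2 ℕ.+ c) ℕ.* 4       ≤⟨ ℕ.*-monoˡ-≤ 4 (m<n∸1⇒2+m≤n (q ℕ./ 4) c<) ⟩
    q ℕ./ 4 ℕ.* 4         ≤⟨ ℕ.m/n*n≤m q 4 ⟩
    q                     ∎
  0<q : 0 < q
  0<q = ℕ.≤-trans (s≤s z≤n) (ℕ.≤-trans (ℕ.m≤n+m 8 (4 ℕ.* c)) 4c+8≤q)

open import Data.Nat.Base using (_^_; _∸_; _/_)

theorem1p1 :
    (h : ℕ) → 1 < h →
    let q = 2 ^ h in
    (F : FiniteField (q ^ 2)) →
    let open FiniteField F
        open ProjectivePlane F
    in
    (U : Pred Carrier 0ℓ) (U? : Decidable U) →
    U ⊆ GF⋆ F q →
    card U? < q / 4 ∸ 1 →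
    let open DualAndréPlane F q U? in
    (Ω : Pred (Carrier × Carrier) 0ℓ) →
    IsAffineRegularHyperoval Ω →
    IsCompleteArc (Ω ⋆)
theorem1p1 (suc g) _ F U U? U⊆ card< Ω hyperoval = complete (normal-form Ω hyperoval)
  where
  q = 2 ^ suc g

  -- The exponent `suc g * 2` unfolds to `suc (suc (g * 2))`, so `suc (g * 2)` is the exponent that
  -- defines square roots.
  n≡ : q ^ 2 ≡ 2 ^ suc (suc (g ℕ.* 2))
  n≡ = ℕ.^-*-assoc 2 (suc g) 2

  open FiniteField F hiding (_^_)
  open DualAndréPlane F q U?
  open Projective F (suc (g ℕ.* 2)) n≡ using (NormalForm; normal-form)
  module Char2 = Characteristic2 F (suc (g ℕ.* 2)) n≡

  involutive : ∀ x → FiniteField._^_ F (FiniteField._^_ F x q) q ≡ x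
  involutive x = trans (Char2.^-assocʳ x q q)
    (trans (cong (λ e → FiniteField._^_ F x (q ℕ.* e)) (sym (ℕ.*-identityʳ q))) (Char2.x^n≡x x))

  2≤q : 2 ≤ q
  2≤q = ℕ.*-monoʳ-≤ 2 (ℕ.m^n>0 2 g)

  bound : 2 ℕ.* (2 ℕ.* suc q ℕ.* card U?) ℕ.+ q ℕ.* 6 < q ^ 2
  bound = counting-bound q (card U?) card<

  complete : NormalForm Ω → IsCompleteArc (Ω ⋆)
  complete (a , h , b , X₀ , Y₀ , anisotropic , Ω⇔On) = ⋆-isArc Ω Ω⇒On On⇒Ω , extension
    where
    open Arcs F (suc (g ℕ.* 2)) n≡ q 2≤q (Char2.frobenius-+ (suc g)) involutive U? U⊆ a h b X₀ Y₀ anisotropic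
    open Hyperoval F (suc (g ℕ.* 2)) n≡ a h b X₀ Y₀ using (On)
    Ω⇒On : ∀ V → Ω V → On V
    Ω⇒On V = Equivalence.to (Ω⇔On V)
    On⇒Ω : ∀ V → On V → Ω V
    On⇒Ω V = Equivalence.from (Ω⇔On V)

    too-small : ¬ (q ^ 2 ≤ 2 ℕ.* (2 ℕ.* suc q ℕ.* card U?))
    too-small ≤ = ℕ.<⇒≱ (ℕ.≤-<-trans (ℕ.m≤m+n _ (q ℕ.* 6)) bound) ≤

    extension : ∀ A → ¬ (Ω ⋆) A → ¬ IsArc ((Ω ⋆) ∪ ｛ A ｝)
    extension (P x y) A∉ arc with U? ∥ x ∥
    ... | yes x∈ = ℕ.<⇒≱ bound (InsidePoint.inside-point-≤ x y x∈ Ω Ω⇒On On⇒Ω arc)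
    ... | no x∉  = too-small (outside-point-≤ Ω Ω⇒On On⇒Ω x y x∉ (λ onA → A∉ (On⇒Ω _ onA , x∉)) arc)
    extension (slope m) A∉ arc = too-small (slope-≤ Ω Ω⇒On On⇒Ω m arc)
    extension vertical  A∉ arc = too-small (vertical-≤ Ω Ω⇒On On⇒Ω arc)
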